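{- Let $p$ be a prime, $h\ge1$, $q=p^{2h}$, and let $a_1,\dots,a_h$ be an $\mathbb{F}_p$-basis of $A=\{a\in\mathbb{F}_q: a^{p^h}+a=0\}$. Let $1\le t\le h$ and let $$B=\{(x,y_1,\dots,y_t)\in\mathbb{F}_q^{t+1}:\ y_i^p-y_i=a_ix^{p^h+1}\ \text{for all } i\in[t]\},$$ ordered as $Q_1,\dots,Q_n$. Let $l=q-tp^h+2tp^{h-1}-t$, $$V=\operatorname{Span}_{\mathbb{F}_q}\{x^jy_1^{e_1}\cdots y_t^{e_t}:\ 0\le j\le l,\ 0\le e_i\le p-2\},$$ and $C=\{(f(Q_1),\dots,f(Q_n)):f\in V\}$. Then $C$ is a linear $[n,k,d]$ code over $\mathbb{F}_q$ with availability $t$ and locality $(p-1,\dots,p-1)$ (the $j$-th recovery set of the position of $(\alpha,\beta_1,\dots,\beta_t)$ consisting of the other points of $B$ with $x=\alpha$ and $y_k=\beta_k$ for all $k\ne j$), where $$n=p^tq,\qquad k=(q-tp^h+2tp^{h-1}-t+1)(p-1)^t,\qquad d\ge 2tp^{t-1}.$$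
   Context: This is the code $C(l\infty_x,B)$ on the fiber product over $\mathbb{P}^1_x$ of the Artin–Schreier curves $\mathcal{Y}_{a_i}: y^p-y=a_ix^{p^h+1}$, $i\in[t]$, with $B$ the affine $\mathbb{F}_q$-rational points. A linear code of length $n$ has availability $t$ and locality $(r_1,\dots,r_t)$ if each position $i$ has pairwise disjoint sets $A_{i1},\dots,A_{it}\subseteq[n]\setminus\{i\}$ with $|A_{ij}|=r_j$ such that the $i$-th entry of every codeword is a function of its entries on $A_{ij}$, for each $j$. -}

module Defs where

open import Level using (0ℓ)
open import Algebra.Bundles using (CommutativeRing; Semiring)
import Algebra.Definitions.RawSemiring as RS
open import Data.Nat using (ℕ; zero; suc; _∸_; _≤_)
  renaming (_*_ to _*ℕ_; _^_ to _^ℕ_; _+_ to _+ℕ_)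
open import Data.Fin using (Fin; zero; suc; inject≤; toℕ)
open import Data.Product using (Σ; ∃; ∃-syntax; _×_; _,_; proj₁; proj₂)
open import Relation.Binary.PropositionalEquality using (_≡_; _≢_)
open import Relation.Nullary using (¬_)
open import Data.Empty using (⊥)

module _ (R : CommutativeRing 0ℓ 0ℓ) where
  open CommutativeRing R using (Carrier; _≈_; _+_; _*_; _-_; 0#; 1#; semiring)
  open RS (Semiring.rawSemiring semiring) using (_^_) renaming (_×_ to _·_)

  Σ[_]_ : (n : ℕ) → (Fin n → Carrier) → Carrier
  Σ[ zero ] f = 0#
  Σ[ suc n ] f = f zero + Σ[ n ] (λ i → f (suc i))

  Π[_]_ : (n : ℕ) → (Fin n → Carrier) → Carrier
  Π[ zero ] f = 1#
  Π[ suc n ] f = f zero * Π[ n ] (λ i → f (suc i))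

  ΣFun : (t m : ℕ) → ((Fin t → Fin m) → Carrier) → Carrier
  ΣFun zero m g = g (λ ())
  ΣFun (suc t) m g =
    Σ[ m ] (λ i → ΣFun t m (λ e → g (λ { zero → i ; (suc k) → e k })))

  IsField : Set
  IsField = (¬ (0# ≈ 1#)) × (∀ x → ¬ (x ≈ 0#) → ∃[ y ] (x * y ≈ 1#))

  HasOrder : ℕ → Set
  HasOrder q = Σ (Fin q → Carrier) λ f →
    (∀ i j → f i ≈ f j → i ≡ j) × (∀ x → ∃[ i ] (f i ≈ x))

  InA : ℕ → ℕ → Carrier → Set
  InA p h z = z ^ (p ^ℕ h) + z ≈ 0#

  -- F_p-linear combination with coefficients in {0,…,p-1}
  Comb : (p h : ℕ) → (Fin h → Carrier) → (Fin h → Fin p) → Carrier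
  Comb p h a c = Σ[ h ] (λ i → toℕ (c i) · a i)

  IsBasisOfA : (p h : ℕ) → (Fin h → Carrier) → Set
  IsBasisOfA p h a =
    (∀ i → InA p h (a i)) ×
    (∀ c → Comb p h a c ≈ 0# → ∀ i → toℕ (c i) ≡ 0) ×
    (∀ z → InA p h z → ∃[ c ] (z ≈ Comb p h a c))

  Pt : ℕ → Set
  Pt t = Carrier × (Fin t → Carrier)

  InB : (p h t : ℕ) → (Fin t → Carrier) → Pt t → Set
  InB p h t a (x , y) = ∀ i → y i ^ p - y i ≈ a i * x ^ (p ^ℕ h +ℕ 1)

  _≈Pt_ : {t : ℕ} → Pt t → Pt t → Set
  (x , y) ≈Pt (x' , y') = (x ≈ x') × (∀ i → y i ≈ y' i)

  IsOrderingOfB : (p h t n : ℕ) → (Fin t → Carrier) → (Fin n → Pt t) → Set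
  IsOrderingOfB p h t n a Q =
    (∀ i → InB p h t a (Q i)) ×
    (∀ i j → Q i ≈Pt Q j → i ≡ j) ×
    (∀ P → InB p h t a P → ∃[ i ] (Q i ≈Pt P))

  evalV : (p t l : ℕ) → (Fin (suc l) → (Fin t → Fin (p ∸ 1)) → Carrier) →
          Pt t → Carrier
  evalV p t l coef (x , y) =
    Σ[ suc l ] (λ j → ΣFun t (p ∸ 1) (λ e →
      coef j e * (x ^ toℕ j * Π[ t ] (λ k → y k ^ toℕ (e k)))))

  Word : ℕ → Set
  Word n = Fin n → Carrier

  InC : (p t l n : ℕ) → (Fin n → Pt t) → Word n → Set
  InC p t l n Q c = ∃[ coef ] (∀ i → c i ≈ evalV p t l coef (Q i))

  IsLinear : (n : ℕ) → (Word n → Set) → Set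
  IsLinear n C =
    C (λ _ → 0#) ×
    (∀ c c' → C c → C c' → C (λ i → c i + c' i)) ×
    (∀ λ' c → C c → C (λ i → λ' * c i))

  HasDimension : (n : ℕ) → (Word n → Set) → ℕ → Set
  HasDimension n C k = Σ (Fin k → Word n) λ G →
    (∀ j → C (G j)) ×
    (∀ (λ' : Fin k → Carrier) →
       (∀ i → Σ[ k ] (λ j → λ' j * G j i) ≈ 0#) → ∀ j → λ' j ≈ 0#) ×
    (∀ c → C c → Σ (Fin k → Carrier) λ λ' → (∀ i → c i ≈ Σ[ k ] (λ j → λ' j * G j i)))

  WeightAtLeast : (n : ℕ) → Word n → ℕ → Set
  WeightAtLeast n c d = Σ (Fin d → Fin n) λ f →
    (∀ u v → f u ≡ f v → u ≡ v) × (∀ u → ¬ (c (f u) ≈ 0#))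

  MinDistAtLeast : (n : ℕ) → (Word n → Set) → ℕ → Set
  MinDistAtLeast n C d =
    ∀ c → C c → ¬ (∀ i → c i ≈ 0#) → WeightAtLeast n c d

  HasSize : (n : ℕ) → (Fin n → Set) → ℕ → Set
  HasSize n S r = Σ (Fin r → Fin n) λ f →
    (∀ u v → f u ≡ f v → u ≡ v) × (∀ u → S (f u)) × (∀ i → S i → ∃[ u ] (f u ≡ i))

  RecSet : (t n : ℕ) → (Fin n → Pt t) → Fin n → Fin t → Fin n → Set
  RecSet t n Q i j i' =
    (i' ≢ i) × (proj₁ (Q i') ≈ proj₁ (Q i)) ×
    (∀ k → k ≢ j → proj₂ (Q i') k ≈ proj₂ (Q i) k)

  HasAvailabilityLocality : (n t r : ℕ) → (Word n → Set) →
                            (Fin n → Fin t → Fin n → Set) → Set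
  HasAvailabilityLocality n t r C A =
    (∀ i j → ¬ A i j i) ×
    (∀ i j j' i' → j ≢ j' → A i j i' → A i j' i' → ⊥) ×
    (∀ i j → HasSize n (A i j) r) ×
    (∀ i j c c' → C c → C c' → (∀ i' → A i j i' → c i' ≈ c' i') → c i ≈ c' i)

{-# OPTIONS --safe #-}

-- Every fibre of B over x is a full grid: c = a x^(p^h+1) satisfies c^(p^h) = −c, hence has trace 0,
-- so by additive Hilbert 90 the equation y^p − y = c is solvable and its solutions form a coset of F_p.
-- This gives n = p^t q.  If f ∈ V has a nonzero coefficient at x^j y^e, then the coefficient of y^e is
-- a nonzero polynomial in x of degree at most l, nonzero at q − l or more values of x; over each of
-- them f is a nonzero polynomial in y of degree at most p − 2 in each variable, hence nonzero at 2^t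
-- or more points of the grid.  So the weight is at least (q − l) 2^t, where
-- q − l = t ((p − 2) p^(h−1) + 1); this implies d ≥ 2 t p^(t−1) and the injectivity of evaluation on V.
-- Recovery along a line of the grid is interpolation of degree at most p − 2 from p − 1 values.
module Submission where

open import Defs
open import Level using (0ℓ)
open import Algebra.Bundles using (CommutativeRing)
open import Data.Nat as ℕ using (ℕ; zero; suc; _∸_; _≤_; _<_; s≤s; z≤n)
import Data.Nat.Properties as ℕₚ
open import Data.Nat.Combinatorics using (nCn≡1; nC1≡n; nCk≡nC[n∸k]; nCk+nC[k+1]≡[n+1]C[k+1]) renaming (_C_ to _choose_)
open import Data.Nat.Divisibility using (_∣_; divides)
open import Data.Nat.Coprimality using (prime⇒coprime; coprime-divisor; coprime-Bézout)
open import Data.Nat.GCD using (module Bézout)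
open import Data.Nat.Primality using (Prime; ¬prime[0]; ¬prime[1])
open import Data.Nat.Solver using (module +-*-Solver)
open import Data.Fin using (Fin; zero; suc; toℕ; fromℕ; inject₁; inject≤; fromℕ<; punchIn; combine; quotient; remainder; _↑ˡ_; _↑ʳ_; finToFun; funToFin)
import Data.Fin.Properties as Finₚ
open import Data.Fin.Permutation using (Permutation; permutation; _⟨$⟩ʳ_)
open import Data.Product using (Σ; ∃; _×_; _,_; proj₁; proj₂)
open import Function using (_∘_)
open import Relation.Binary.Definitions using (tri<; tri≈; tri>)
open import Relation.Nullary using (¬_; Dec; yes; no; contradiction)
open import Relation.Nullary.Decidable using (decidable-stable)
import Relation.Binary.PropositionalEquality as ≡
open ≡ using (_≡_; _≢_)

-- Why the trace vanishes: `x ^ (p ^ h + 1)` is the norm of `x` to the subfield with `p ^ h`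
-- elements, so raising to the power `p ^ h` fixes it, while it negates every element of A. In the
-- trace, a sum of `2h` conjugates, the conjugates numbered `i` and `i + h` therefore cancel. The
-- field is given only by `_≈_` and a listing of its elements. Decidable equality, the
-- characteristic and `x ^ q ≈ x` are all extracted from that listing. Exponent vectors are
-- functions and have no extensional equality, so coefficient families are reindexed by the numbers
-- below `suc l * (p - 1) ^ t`, whose digits are the exponents.

-- Finite sums and products; univariate polynomials over a commutative ring.

module Sums (R : CommutativeRing 0ℓ 0ℓ) where
  open CommutativeRing R hiding (zero)
  open import Algebra.Properties.CommutativeSemiring.Exp commutativeSemiring public
  open import Algebra.Properties.Semiring.Mult semiring public
    using (×-congʳ; ×-congˡ; ×-homo-+; ×1-homo-*; ×-assoc-*) renaming (_×_ to _·_)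
  open import Relation.Binary.Reasoning.Setoid setoid
  open import Algebra.Solver.Ring.NaturalCoefficients.Default commutativeSemiring
    using (solve; _:=_; _:+_; _:*_)
  import Algebra.Properties.Semiring.Sum semiring as Add
  import Algebra.Properties.CommutativeMonoid.Sum *-commutativeMonoid as Mul

  Annihilates1 : ℕ → Set
  Annihilates1 n = n · 1# ≈ 0#

  -- Opacity lets unification recover the summand of a sum of unknown length.
  opaque
    sum product : ∀ {n} → (Fin n → Carrier) → Carrier
    sum = Add.sum
    product = Mul.sum

    sum-def : ∀ {n} (f : Fin n → Carrier) → sum f ≡ Add.sum f
    sum-def f = ≡.refl

    Σ≡sum : ∀ {n} (f : Fin n → Carrier) → (Σ[_]_ R n f) ≡ sum f
    Σ≡sum {zero} f = ≡.refl
    Σ≡sum {suc n} f = ≡.cong (f zero +_) (Σ≡sum (f ∘ suc))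

    Π≡product : ∀ {n} (f : Fin n → Carrier) → (Π[_]_ R n f) ≡ product f
    Π≡product {zero} f = ≡.refl
    Π≡product {suc n} f = ≡.cong (f zero *_) (Π≡product (f ∘ suc))

    sum-[] : (f : Fin 0 → Carrier) → sum f ≈ 0#
    sum-[] f = refl

    sum-∷ : ∀ {n} (f : Fin (suc n) → Carrier) → sum f ≈ f zero + sum (f ∘ suc)
    sum-∷ f = refl

    sum-∷ʳ : ∀ {n} (f : Fin (suc n) → Carrier) → sum f ≈ sum (f ∘ inject₁) + f (fromℕ n)
    sum-∷ʳ f = Add.sum-init-last f

    sum-cong : ∀ {n} {f g : Fin n → Carrier} → (∀ i → f i ≈ g i) → sum f ≈ sum g
    sum-cong = Add.sum-cong-≋

    sum-replicate : ∀ n x → sum {n} (λ _ → x) ≈ n · x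
    sum-replicate n x = Add.sum-replicate n

    sum-remove : ∀ {n} (i : Fin (suc n)) f → sum f ≈ f i + sum (f ∘ punchIn i)
    sum-remove i f = Add.sum-remove {i = i} f

    sum-permute : ∀ {n} (f : Fin n → Carrier) (π : Permutation n n) → sum f ≈ sum (λ i → f (π ⟨$⟩ʳ i))
    sum-permute = Add.sum-permute

    sum-+ : ∀ {n} (f g : Fin n → Carrier) → sum (λ i → f i + g i) ≈ sum f + sum g
    sum-+ = Add.∑-distrib-+

    sum-comm : ∀ {m n} (f : Fin m → Fin n → Carrier) →
               sum (λ i → sum (f i)) ≈ sum (λ j → sum (λ i → f i j))
    sum-comm = Add.∑-comm

    *-distribˡ-sum : ∀ {n} x (f : Fin n → Carrier) → x * sum f ≈ sum (λ i → x * f i)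
    *-distribˡ-sum = Add.*-distribˡ-sum

    *-distribʳ-sum : ∀ {n} x (f : Fin n → Carrier) → sum f * x ≈ sum (λ i → f i * x)
    *-distribʳ-sum = Add.*-distribʳ-sum

    product-[] : (f : Fin 0 → Carrier) → product f ≈ 1#
    product-[] f = refl

    product-∷ : ∀ {n} (f : Fin (suc n) → Carrier) → product f ≈ f zero * product (f ∘ suc)
    product-∷ f = refl

    product-cong : ∀ {n} {f g : Fin n → Carrier} → (∀ i → f i ≈ g i) → product f ≈ product g
    product-cong = Mul.sum-cong-≋

    product-replicate : ∀ n x → product {n} (λ _ → x) ≈ x ^ n
    product-replicate n x = Mul.sum-replicate n

    product-remove : ∀ {n} (i : Fin (suc n)) f → product f ≈ f i * product (f ∘ punchIn i)
    product-remove i f = Mul.sum-remove {i = i} f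

    product-permute : ∀ {n} (f : Fin n → Carrier) (π : Permutation n n) →
                      product f ≈ product (λ i → f (π ⟨$⟩ʳ i))
    product-permute = Mul.sum-permute

    product-* : ∀ {n} (f g : Fin n → Carrier) → product (λ i → f i * g i) ≈ product f * product g
    product-* = Mul.∑-distrib-+

  sum-zero : ∀ {n} (f : Fin n → Carrier) → (∀ i → f i ≈ 0#) → sum f ≈ 0#
  sum-zero {zero} f f≈0 = sum-[] f
  sum-zero {suc n} f f≈0 =
    trans (sum-∷ f) (trans (+-cong (f≈0 zero) (sum-zero (f ∘ suc) (f≈0 ∘ suc))) (+-identityˡ _))

  sum-single : ∀ {n} (f : Fin n → Carrier) i → (∀ j → j ≢ i → f j ≈ 0#) → sum f ≈ f i
  sum-single {suc n} f i f≈0 = begin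
    sum f                        ≈⟨ sum-remove i f ⟩
    f i + sum (f ∘ punchIn i)    ≈⟨ +-congˡ (sum-zero _ λ j → f≈0 _ (Finₚ.punchInᵢ≢i i j)) ⟩
    f i + 0#                     ≈⟨ +-identityʳ _ ⟩
    f i                          ∎

  sum-++ : ∀ m {n} (f : Fin (m ℕ.+ n) → Carrier) →
           sum f ≈ sum (f ∘ (_↑ˡ n)) + sum (f ∘ (m ↑ʳ_))
  sum-++ zero f = sym (trans (+-congʳ (sum-[] _)) (+-identityˡ _))
  sum-++ (suc m) f = trans (sum-∷ f) (trans (+-congˡ (sum-++ m (f ∘ suc)))
    (trans (sym (+-assoc _ _ _)) (+-congʳ (sym (sum-∷ _)))))

  sum-combine : ∀ m {n} (f : Fin (m ℕ.* n) → Carrier) →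
                sum f ≈ sum {m} λ i → sum {n} λ j → f (combine i j)
  sum-combine zero f = trans (sum-[] _) (sym (sum-[] _))
  sum-combine (suc m) {n} f =
    trans (sum-++ n f) (trans (+-congˡ (sum-combine m (f ∘ (n ↑ʳ_)))) (sym (sum-∷ _)))

  δ : ∀ {n} → Fin n → Fin n → Carrier
  δ i j with i Finₚ.≟ j
  ... | yes _ = 1#
  ... | no  _ = 0#

  δ-refl : ∀ {n} (i : Fin n) → δ i i ≈ 1#
  δ-refl i with i Finₚ.≟ i
  ... | yes _   = refl
  ... | no  i≢i = contradiction ≡.refl i≢i

  δ-≢ : ∀ {n} {i j : Fin n} → i ≢ j → δ i j ≈ 0#
  δ-≢ {i = i} {j} i≢j with i Finₚ.≟ j
  ... | yes i≡j = contradiction i≡j i≢j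
  ... | no  _   = refl

  sum-δ : ∀ {n} i (f : Fin n → Carrier) → sum (λ j → δ i j * f j) ≈ f i
  sum-δ i f = begin
    sum (λ j → δ i j * f j)  ≈⟨ sum-single _ i (λ j j≢i → trans (*-congʳ (δ-≢ (j≢i ∘ ≡.sym))) (zeroˡ _)) ⟩
    δ i i * f i              ≈⟨ *-congʳ (δ-refl i) ⟩
    1# * f i                 ≈⟨ *-identityˡ _ ⟩
    f i                      ∎

  eval : ∀ {m} → (Fin m → Carrier) → Carrier → Carrier
  eval c x = sum λ i → c i * x ^ toℕ i

  eval-suc : ∀ {m} (c : Fin (suc m) → Carrier) x →
             eval c x ≈ c zero + x * eval (c ∘ suc) x
  eval-suc c x = trans (sum-∷ _) (+-cong (*-identityʳ _) (begin
    sum (λ i → c (suc i) * (x * x ^ toℕ i))  ≈⟨ sum-cong (λ i → solve 3 (λ a b d → a :* (b :* d) := b :* (a :* d)) refl (c (suc i)) x (x ^ toℕ i)) ⟩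
    sum (λ i → x * (c (suc i) * x ^ toℕ i))  ≈⟨ *-distribˡ-sum x _ ⟨
    x * eval (c ∘ suc) x                     ∎))

  eval-δ : ∀ {m} (k : Fin m) x → eval (δ k) x ≈ x ^ toℕ k
  eval-δ k x = sum-δ k (λ i → x ^ toℕ i)

  eval-+ : ∀ {m} (c d : Fin m → Carrier) x → eval (λ i → c i + d i) x ≈ eval c x + eval d x
  eval-+ c d x = trans (sum-cong λ i → distribʳ _ _ _) (sum-+ _ _)

  eval-* : ∀ {m} a (c : Fin m → Carrier) x → eval (λ i → a * c i) x ≈ a * eval c x
  eval-* a c x = trans (sum-cong λ i → *-assoc _ _ _) (sym (*-distribˡ-sum a _))

  eval-sum : ∀ {m n} (c : Fin n → Fin m → Carrier) x →
             eval (λ i → sum λ j → c j i) x ≈ sum λ j → eval (c j) x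
  eval-sum {n = n} c x = trans (sum-cong λ i → *-distribʳ-sum (x ^ toℕ i) (λ j → c j i)) (sum-comm _)

  -- Synthetic division by `x - r`: by Horner's rule each coefficient of the quotient is the value
  -- at `r` of the part of the polynomial above it.
  quotientAt : ∀ {m} → Carrier → (Fin (suc m) → Carrier) → Fin m → Carrier
  quotientAt r c zero    = eval (c ∘ suc) r
  quotientAt r c (suc i) = quotientAt r (c ∘ suc) i

  -- P(x) − P(r) = (x − r) Q(x), arranged so that no subtraction occurs.
  quotientAt-eval : ∀ {m} (c : Fin (suc m) → Carrier) r x →
    eval c x + r * eval (quotientAt r c) x ≈ eval c r + x * eval (quotientAt r c) x
  quotientAt-eval {zero} c r x =
    +-cong (trans (eval-suc c x) (trans (+-congˡ (no-terms x)) (sym (trans (eval-suc c r) (+-congˡ (no-terms r))))))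
           (trans (no-terms r) (sym (no-terms x)))
    where
    no-terms : ∀ z {f : Fin 0 → Carrier} → z * sum f ≈ 0#
    no-terms z = trans (*-congˡ (sum-[] _)) (zeroʳ z)
  quotientAt-eval {suc m} c r x = begin
    eval c x + r * eval Q x
      ≈⟨ +-cong (eval-suc c x) (*-congˡ (eval-suc Q x)) ⟩
    (c zero + x * eval c′ x) + r * (eval c′ r + x * eval Q′ x)
      ≈⟨ solve 6 (λ a x p r e q → (a :+ x :* p) :+ r :* (e :+ x :* q) := (a :+ r :* e) :+ x :* (p :+ r :* q)) refl
           (c zero) x (eval c′ x) r (eval c′ r) (eval Q′ x) ⟩
    (c zero + r * eval c′ r) + x * (eval c′ x + r * eval Q′ x)
      ≈⟨ +-cong (sym (eval-suc c r)) (*-congˡ (trans (quotientAt-eval c′ r x) (sym (eval-suc Q x)))) ⟩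
    eval c r + x * eval Q x ∎
    where
    c′ = c ∘ suc
    Q = quotientAt r c
    Q′ = quotientAt r c′

  -- Dividing out a root loses no information: a Horner step writes each value as a coefficient plus
  -- `r` times the next value, so if all values vanish the coefficients do too.
  quotientAt-zero : ∀ {m} (c : Fin (suc m) → Carrier) r → eval c r ≈ 0# →
                    (∀ i → quotientAt r c i ≈ 0#) → ∀ i → c i ≈ 0#
  quotientAt-zero {zero} c r cr≈0 Q≈0 zero =
    trans (sym (trans (eval-suc c r) (trans (+-congˡ (trans (*-congˡ (sum-[] _)) (zeroʳ r))) (+-identityʳ _)))) cr≈0
  quotientAt-zero {suc m} c r cr≈0 Q≈0 zero = begin
    c zero                         ≈⟨ +-identityʳ _ ⟨
    c zero + 0#                    ≈⟨ +-congˡ (zeroʳ r) ⟨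
    c zero + r * 0#                ≈⟨ +-congˡ (*-congˡ (Q≈0 zero)) ⟨
    c zero + r * eval (c ∘ suc) r  ≈⟨ eval-suc c r ⟨
    eval c r                       ≈⟨ cr≈0 ⟩
    0#                             ∎
  quotientAt-zero {suc m} c r cr≈0 Q≈0 (suc i) =
    quotientAt-zero (c ∘ suc) r (Q≈0 zero) (Q≈0 ∘ suc) i

-- Divisibility of binomial coefficients by a prime.

[1+k]*[1+n]C[1+k]≡[1+n]*nCk : ∀ n k → suc k ℕ.* (suc n choose suc k) ≡ suc n ℕ.* (n choose k)
[1+k]*[1+n]C[1+k]≡[1+n]*nCk n zero = begin
  1 ℕ.* (suc n choose 1)    ≡⟨ ℕₚ.*-identityˡ _ ⟩
  suc n choose 1            ≡⟨ nC1≡n (suc n) ⟩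
  suc n                ≡⟨ ℕₚ.*-identityʳ _ ⟨
  suc n ℕ.* 1          ≡⟨ ≡.cong (suc n ℕ.*_) (≡.trans (nCk≡nC[n∸k] {0} {n} z≤n) (nCn≡1 n)) ⟨
  suc n ℕ.* (n choose 0)    ∎
  where open ≡.≡-Reasoning
[1+k]*[1+n]C[1+k]≡[1+n]*nCk zero (suc k) = ℕₚ.*-zeroʳ (suc (suc k))
[1+k]*[1+n]C[1+k]≡[1+n]*nCk (suc n) (suc k) = begin
  suc (suc k) ℕ.* (suc (suc n) choose suc (suc k))
    ≡⟨ ≡.cong (suc (suc k) ℕ.*_) (nCk+nC[k+1]≡[n+1]C[k+1] (suc n) (suc k)) ⟨
  suc (suc k) ℕ.* ((suc n choose suc k) ℕ.+ (suc n choose suc (suc k)))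
    ≡⟨ solve 3 (λ k a b → (con 2 :+ k) :* (a :+ b) := a :+ (con 1 :+ k) :* a :+ (con 2 :+ k) :* b) ≡.refl k (suc n choose suc k) (suc n choose suc (suc k)) ⟩
  (suc n choose suc k) ℕ.+ suc k ℕ.* (suc n choose suc k) ℕ.+ suc (suc k) ℕ.* (suc n choose suc (suc k))
    ≡⟨ ≡.cong₂ (λ u v → (suc n choose suc k) ℕ.+ u ℕ.+ v) ([1+k]*[1+n]C[1+k]≡[1+n]*nCk n k) ([1+k]*[1+n]C[1+k]≡[1+n]*nCk n (suc k)) ⟩
  (suc n choose suc k) ℕ.+ suc n ℕ.* (n choose k) ℕ.+ suc n ℕ.* (n choose suc k)
    ≡⟨ solve 4 (λ a n b c → a :+ (con 1 :+ n) :* b :+ (con 1 :+ n) :* c := a :+ (con 1 :+ n) :* (b :+ c)) ≡.refl (suc n choose suc k) n (n choose k) (n choose suc k) ⟩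
  (suc n choose suc k) ℕ.+ suc n ℕ.* ((n choose k) ℕ.+ (n choose suc k))
    ≡⟨ ≡.cong (λ u → (suc n choose suc k) ℕ.+ suc n ℕ.* u) (nCk+nC[k+1]≡[n+1]C[k+1] n k) ⟩
  suc (suc n) ℕ.* (suc n choose suc k) ∎
  where
  open ≡.≡-Reasoning
  open +-*-Solver

-- In the absorption identity the prime divides the right-hand side and is coprime to the factor
-- `suc k` on the left.
prime∣binomial : ∀ {n} → Prime (suc n) → ∀ {k} → suc k < suc n → suc n ∣ suc n choose suc k
prime∣binomial {n} p-prime {k} k<n = coprime-divisor (prime⇒coprime p-prime k<n)
  (divides (n choose k) (≡.trans ([1+k]*[1+n]C[1+k]≡[1+n]*nCk n k) (ℕₚ.*-comm (suc n) (n choose k))))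

-- Arithmetic of a finite field: roots, characteristic, Fermat's identity.

module FiniteField (R : CommutativeRing 0ℓ 0ℓ) (isField : IsField R)
                   {q : ℕ} (hasOrder : HasOrder R q) where
  open CommutativeRing R hiding (zero)
  open Sums R
  open import Relation.Binary.Reasoning.Setoid setoid
  open import Algebra.Properties.AbelianGroup +-abelianGroup
    using () renaming (∙-cancelˡ to +-cancelˡ)

  elt : Fin q → Carrier
  elt = proj₁ hasOrder

  elt-injective : ∀ i j → elt i ≈ elt j → i ≡ j
  elt-injective = proj₁ (proj₂ hasOrder)

  index : Carrier → Fin q
  index x = proj₁ (proj₂ (proj₂ hasOrder) x)

  elt-index : ∀ x → elt (index x) ≈ x
  elt-index x = proj₂ (proj₂ (proj₂ hasOrder) x)

  infix 4 _≈?_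
  _≈?_ : ∀ x y → Dec (x ≈ y)
  x ≈? y with index x Finₚ.≟ index y
  ... | yes i≡j = yes (trans (sym (elt-index x)) (trans (reflexive (≡.cong elt i≡j)) (elt-index y)))
  ... | no  i≢j = no λ x≈y → i≢j (elt-injective _ _ (trans (elt-index x) (trans x≈y (sym (elt-index y)))))

  1≉0 : ¬ 1# ≈ 0#
  1≉0 1≈0 = proj₁ isField (sym 1≈0)

  inverse : ∀ x → ¬ x ≈ 0# → ∃ λ y → x * y ≈ 1#
  inverse = proj₂ isField

  *-cancelʳ : ∀ {x y z} → ¬ z ≈ 0# → x * z ≈ y * z → x ≈ y
  *-cancelʳ {x} {y} {z} z≉0 xz≈yz with inverse z z≉0
  ... | w , zw≈1 = begin
    x            ≈⟨ *-identityʳ x ⟨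
    x * 1#       ≈⟨ *-congˡ zw≈1 ⟨
    x * (z * w)  ≈⟨ *-assoc _ _ _ ⟨
    (x * z) * w  ≈⟨ *-congʳ xz≈yz ⟩
    (y * z) * w  ≈⟨ *-assoc _ _ _ ⟩
    y * (z * w)  ≈⟨ *-congˡ zw≈1 ⟩
    y * 1#       ≈⟨ *-identityʳ y ⟩
    y            ∎

  *-≉0 : ∀ {x y} → ¬ x ≈ 0# → ¬ y ≈ 0# → ¬ x * y ≈ 0#
  *-≉0 x≉0 y≉0 xy≈0 = x≉0 (*-cancelʳ y≉0 (trans xy≈0 (sym (zeroˡ _))))

  ^-≉0 : ∀ {x} n → ¬ x ≈ 0# → ¬ x ^ n ≈ 0#
  ^-≉0 zero    x≉0 = 1≉0
  ^-≉0 (suc n) x≉0 = *-≉0 x≉0 (^-≉0 n x≉0)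

  product-≉0 : ∀ {n} (f : Fin n → Carrier) → (∀ i → ¬ f i ≈ 0#) → ¬ product f ≈ 0#
  product-≉0 {zero} f f≉0 f≈0 = 1≉0 (trans (sym (product-[] f)) f≈0)
  product-≉0 {suc n} f f≉0 f≈0 =
    *-≉0 (f≉0 zero) (product-≉0 (f ∘ suc) (f≉0 ∘ suc)) (trans (sym (product-∷ f)) f≈0)

  -- Induction on the number of roots: at a later root `r (suc i)`, the division identity reads
  -- `r zero * Q ≈ r (suc i) * Q`, and the two points differ, so the quotient vanishes there.
  eval-roots : ∀ {m} (c r : Fin m → Carrier) → (∀ i j → r i ≈ r j → i ≡ j) →
               (∀ i → eval c (r i) ≈ 0#) → ∀ i → c i ≈ 0#
  eval-roots {suc m} c r r-inj c[r]≈0 =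
    quotientAt-zero c r₀ (c[r]≈0 zero)
      (eval-roots Q (r ∘ suc) (λ i j → Finₚ.suc-injective ∘ r-inj _ _) Q[r]≈0)
    where
    r₀ = r zero
    Q = quotientAt r₀ c
    Q[r]≈0 : ∀ i → eval Q (r (suc i)) ≈ 0#
    Q[r]≈0 i = decidable-stable (eval Q (r (suc i)) ≈? 0#) λ Q≉0 →
      Finₚ.0≢1+n (r-inj _ _ (*-cancelʳ Q≉0 (+-cancelˡ 0# _ _ (begin
        0# + r₀ * eval Q (r (suc i))                 ≈⟨ +-congʳ (c[r]≈0 (suc i)) ⟨
        eval c (r (suc i)) + r₀ * eval Q (r (suc i)) ≈⟨ quotientAt-eval c r₀ (r (suc i)) ⟩
        eval c r₀ + r (suc i) * eval Q (r (suc i))   ≈⟨ +-congʳ (c[r]≈0 zero) ⟩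
        0# + r (suc i) * eval Q (r (suc i))          ∎))))

  eval-determined : ∀ {m} (b c r : Fin m → Carrier) → (∀ i j → r i ≈ r j → i ≡ j) →
                    (∀ i → eval b (r i) ≈ eval c (r i)) → ∀ i → b i ≈ c i
  eval-determined b c r r-inj b[r]≈c[r] i = begin
    b i                        ≈⟨ +-identityʳ _ ⟨
    b i + 0#                   ≈⟨ +-congˡ (trans (*-congʳ (-‿inverseˡ 1#)) (zeroˡ (c i))) ⟨
    b i + (- 1# + 1#) * c i    ≈⟨ +-congˡ (trans (distribʳ _ _ _) (+-congˡ (*-identityˡ _))) ⟩
    b i + (- 1# * c i + c i)   ≈⟨ +-assoc _ _ _ ⟨
    (b i + - 1# * c i) + c i   ≈⟨ +-congʳ (eval-roots (λ k → b k + - 1# * c k) r r-inj difference i) ⟩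
    0# + c i                   ≈⟨ +-identityˡ _ ⟩
    c i                        ∎
    where
    difference : ∀ j → eval (λ k → b k + - 1# * c k) (r j) ≈ 0#
    difference j = begin
      eval (λ k → b k + - 1# * c k) (r j)               ≈⟨ eval-+ b _ (r j) ⟩
      eval b (r j) + eval (λ k → - 1# * c k) (r j)      ≈⟨ +-cong (trans (b[r]≈c[r] j) (sym (*-identityˡ _))) (eval-* (- 1#) c (r j)) ⟩
      1# * eval c (r j) + - 1# * eval c (r j)           ≈⟨ distribʳ _ _ _ ⟨
      (1# + - 1#) * eval c (r j)                        ≈⟨ trans (*-congʳ (-‿inverseʳ 1#)) (zeroˡ _) ⟩
      0#                                                ∎

  permuted : (f g : Carrier → Carrier) → (∀ {x y} → x ≈ y → f x ≈ f y) → (∀ {x y} → x ≈ y → g x ≈ g y) →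
             (∀ x → f (g x) ≈ x) → (∀ x → g (f x) ≈ x) → Permutation q q
  permuted f g f-cong g-cong fg≈id gf≈id =
    permutation (index ∘ f ∘ elt) (index ∘ g ∘ elt) (inv f-cong fg≈id) (inv g-cong gf≈id)
    where
    inv : ∀ {f g : Carrier → Carrier} → (∀ {x y} → x ≈ y → f x ≈ f y) → (∀ x → f (g x) ≈ x) →
          ∀ i → index (f (elt (index (g (elt i))))) ≡ i
    inv f-cong fg≈id i = elt-injective _ _
      (trans (elt-index _) (trans (f-cong (elt-index _)) (fg≈id _)))

  -- Translation by `1#` permutes the field, so the sum of all elements is unchanged when `1#` is
  -- added to each of its `q` terms.
  q·1≈0 : q · 1# ≈ 0#
  q·1≈0 = +-cancelˡ (sum elt) _ _ (begin
    sum elt + q · 1#                 ≈⟨ +-congˡ (sum-replicate q 1#) ⟨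
    sum elt + sum {q} (λ _ → 1#)     ≈⟨ sum-+ elt (λ _ → 1#) ⟨
    sum (λ i → elt i + 1#)           ≈⟨ sum-cong (λ i → elt-index _) ⟨
    sum (λ i → elt (π ⟨$⟩ʳ i))       ≈⟨ sum-permute elt π ⟨
    sum elt                          ≈⟨ +-identityʳ _ ⟨
    sum elt + 0#                     ∎)
    where
    π = permuted (_+ 1#) (_+ - 1#) +-congʳ +-congʳ
          (λ x → trans (+-assoc _ _ _) (trans (+-congˡ (-‿inverseˡ 1#)) (+-identityʳ x)))
          (λ x → trans (+-assoc _ _ _) (trans (+-congˡ (-‿inverseʳ 1#)) (+-identityʳ x)))

  m^n·1≈[m·1]^n : ∀ m n → (m ℕ.^ n) · 1# ≈ (m · 1#) ^ n
  m^n·1≈[m·1]^n m zero = +-identityʳ 1#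
  m^n·1≈[m·1]^n m (suc n) = trans (×1-homo-* m (m ℕ.^ n)) (*-congˡ (m^n·1≈[m·1]^n m n))

  -- `q · 1#` is the `n`-th power of `p · 1#`, and powers of nonzero elements are nonzero.
  characteristic : ∀ {p n} → q ≡ p ℕ.^ n → Annihilates1 p
  characteristic {p} {n} q≡p^n = decidable-stable (p · 1# ≈? 0#) λ p≉0 →
    ^-≉0 n p≉0 (trans (sym (m^n·1≈[m·1]^n p n)) (trans (×-congˡ (≡.sym q≡p^n)) q·1≈0))

  -- The extra factor `x` makes up for the one at position `i`, so that the exponent is `n` and not
  -- its predecessor.
  product-constant-off : ∀ {n x} i (g : Fin n → Carrier) → g i ≈ 1# → (∀ j → j ≢ i → g j ≈ x) →
                         x * product g ≈ x ^ n
  product-constant-off {suc n} {x} i g gi≈1 g≈x = *-congˡ (begin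
    product g                        ≈⟨ product-remove i g ⟩
    g i * product (g ∘ punchIn i)    ≈⟨ *-congʳ gi≈1 ⟩
    1# * product (g ∘ punchIn i)     ≈⟨ *-identityˡ _ ⟩
    product (g ∘ punchIn i)          ≈⟨ product-cong (λ j → g≈x _ (Finₚ.punchInᵢ≢i i j)) ⟩
    product {n} (λ _ → x)            ≈⟨ product-replicate n x ⟩
    x ^ n                            ∎)

  -- Putting `1#` in the place of the zero element lets a product over the nonzero elements run over
  -- all of `Fin q`, on which multiplication by a unit acts as a permutation.
  unlessZero : Carrier → Carrier → Carrier
  unlessZero z x with z ≈? 0#
  ... | yes _ = 1#
  ... | no  _ = x

  unlessZero-≈0 : ∀ {z} x → z ≈ 0# → unlessZero z x ≈ 1#
  unlessZero-≈0 {z} x z≈0 with z ≈? 0#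
  ... | yes _   = refl
  ... | no  z≉0 = contradiction z≈0 z≉0

  unlessZero-≉0 : ∀ {z} x → ¬ z ≈ 0# → unlessZero z x ≈ x
  unlessZero-≉0 {z} x z≉0 with z ≈? 0#
  ... | yes z≈0 = contradiction z≈0 z≉0
  ... | no  _   = refl

  -- Multiplication by x ≠ 0 permutes the nonzero elements, so it fixes their product.
  x^q≈x : ∀ x → x ^ q ≈ x
  x^q≈x x = trans (sym x*scale≈x^q) (by-cases (x ≈? 0#))
    where
    scale unit : Fin q → Carrier
    scale i = unlessZero (elt i) x
    unit i = unlessZero (elt i) (elt i)

    x*scale≈x^q : x * product scale ≈ x ^ q
    x*scale≈x^q = product-constant-off (index 0#) scale (unlessZero-≈0 x (elt-index 0#))
      (λ j j≢0 → unlessZero-≉0 x λ eltj≈0 → j≢0 (elt-injective _ _ (trans eltj≈0 (sym (elt-index 0#)))))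

    unit-≉0 : ∀ i → ¬ unit i ≈ 0#
    unit-≉0 i with elt i ≈? 0#
    ... | yes _ = 1≉0
    ... | no  e = e

    by-cases : Dec (x ≈ 0#) → x * product scale ≈ x
    by-cases (yes x≈0) = trans (*-congʳ x≈0) (trans (zeroˡ _) (sym x≈0))
    by-cases (no x≉0) = trans (*-congˡ (*-cancelʳ (product-≉0 unit unit-≉0) (begin
      product scale * product unit       ≈⟨ product-* scale unit ⟨
      product (λ i → scale i * unit i)   ≈⟨ product-cong unit-π ⟨
      product (λ i → unit (π ⟨$⟩ʳ i))    ≈⟨ product-permute unit π ⟨
      product unit                       ≈⟨ *-identityˡ _ ⟨
      1# * product unit                  ∎))) (*-identityʳ x)
      where
      x⁻¹ = proj₁ (inverse x x≉0)
      x*x⁻¹≈1 = proj₂ (inverse x x≉0)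
      π = permuted (x *_) (x⁻¹ *_) *-congˡ *-congˡ
            (λ y → trans (sym (*-assoc _ _ _)) (trans (*-congʳ x*x⁻¹≈1) (*-identityˡ y)))
            (λ y → trans (sym (*-assoc _ _ _)) (trans (*-congʳ (trans (*-comm _ _) x*x⁻¹≈1)) (*-identityˡ y)))
      unit-π : ∀ i → unit (π ⟨$⟩ʳ i) ≈ scale i * unit i
      unit-π i with elt (index (x * elt i)) ≈? 0# | elt i ≈? 0#
      ... | yes _ | yes _ = sym (*-identityˡ 1#)
      ... | yes e | no  f = contradiction (trans (sym (elt-index _)) e) (*-≉0 x≉0 f)
      ... | no  e | yes f = contradiction (trans (elt-index _) (trans (*-congˡ f) (zeroʳ x))) e
      ... | no  _ | no  _ = elt-index _

-- Frobenius maps, the prime field, the trace and Artin-Schreier equations.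

module Frobenius (R : CommutativeRing 0ℓ 0ℓ) (isField : IsField R) {q : ℕ} (hasOrder : HasOrder R q)
                 {r : ℕ} (p-prime : Prime (2 ℕ.+ r)) (p·1≈0 : Sums.Annihilates1 R (2 ℕ.+ r)) where
  open CommutativeRing R hiding (zero)
  open Sums R
  open FiniteField R isField hasOrder
  open import Relation.Binary.Reasoning.Setoid setoid
  open import Algebra.Properties.AbelianGroup +-abelianGroup
    using () renaming (∙-cancelˡ to +-cancelˡ; ∙-cancelʳ to +-cancelʳ; inverseʳ-unique to -‿unique)
  open import Algebra.Properties.Ring ring using (-1*x≈-x)
  open import Algebra.Solver.Ring.NaturalCoefficients.Default commutativeSemiring
    using (solve; _:=_; _:+_; _:*_)
  import Algebra.Properties.CommutativeSemiring.Binomial commutativeSemiring as Binomial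

  p : ℕ
  p = 2 ℕ.+ r

  p∣n⇒n·x≈0 : ∀ {n} x → p ∣ n → n · x ≈ 0#
  p∣n⇒n·x≈0 {n} x (divides d n≡d*p) = begin
    n · x                          ≈⟨ ×-congʳ n (*-identityˡ x) ⟨
    n · (1# * x)                   ≈⟨ ×-assoc-* n 1# x ⟨
    (n · 1#) * x                   ≈⟨ *-congʳ (×-congˡ n≡d*p) ⟩
    ((d ℕ.* p) · 1#) * x           ≈⟨ *-congʳ (×1-homo-* d p) ⟩
    ((d · 1#) * (p · 1#)) * x      ≈⟨ *-congʳ (trans (*-congˡ p·1≈0) (zeroʳ _)) ⟩
    0# * x                         ≈⟨ zeroˡ x ⟩
    0#                             ∎

  ^p-+ : ∀ x y → (x + y) ^ p ≈ x ^ p + y ^ p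
  ^p-+ x y = begin
    (x + y) ^ p                                     ≈⟨ Binomial.theorem p x y ⟩
    Binomial.binomialExpansion x y p                ≡⟨ sum-def term ⟨
    sum term                                        ≈⟨ sum-∷ term ⟩
    term zero + sum (term ∘ suc)                    ≈⟨ +-congˡ (sum-∷ʳ (term ∘ suc)) ⟩
    term zero + (sum (term ∘ suc ∘ inject₁) + term (fromℕ p))
      ≈⟨ +-cong first (+-cong (sum-zero _ middle) last) ⟩
    y ^ p + (0# + x ^ p)                            ≈⟨ +-congˡ (+-identityˡ _) ⟩
    y ^ p + x ^ p                                   ≈⟨ +-comm _ _ ⟩
    x ^ p + y ^ p                                   ∎
    where
    term = Binomial.binomialTerm x y p
    first : term zero ≈ y ^ p
    first = trans (×-congˡ (≡.trans (nCk≡nC[n∸k] {0} {p} z≤n) (nCn≡1 p)))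
                  (trans (+-identityʳ _) (*-identityˡ _))
    last : term (fromℕ p) ≈ x ^ p
    last = begin
      (p choose toℕ (fromℕ p)) · (x ^ toℕ (fromℕ p) * y ^ (p ∸ toℕ (fromℕ p)))
        ≡⟨ ≡.cong (λ k → (p choose k) · (x ^ k * y ^ (p ∸ k))) (Finₚ.toℕ-fromℕ p) ⟩
      (p choose p) · (x ^ p * y ^ (p ∸ p))
        ≡⟨ ≡.cong₂ (λ k l → k · (x ^ p * y ^ l)) (nCn≡1 p) (ℕₚ.n∸n≡0 p) ⟩
      1 · (x ^ p * 1#)
        ≈⟨ trans (+-identityʳ _) (*-identityʳ _) ⟩
      x ^ p ∎
    middle : ∀ i → term (suc (inject₁ i)) ≈ 0#
    middle i = p∣n⇒n·x≈0 _ (prime∣binomial p-prime (s≤s (≡.subst (_< suc r) (≡.sym (Finₚ.toℕ-inject₁ i)) (Finₚ.toℕ<n i))))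

  frob : ℕ → Carrier → Carrier
  frob n x = x ^ (p ℕ.^ n)

  frob-cong : ∀ n {x y} → x ≈ y → frob n x ≈ frob n y
  frob-cong n = ^-congˡ (p ℕ.^ n)

  frob-zero : ∀ x → frob 0 x ≈ x
  frob-zero x = *-identityʳ x

  frob-∘ : ∀ m n x → frob (m ℕ.+ n) x ≈ frob n (frob m x)
  frob-∘ m n x = trans (^-congʳ x (ℕₚ.^-distribˡ-+-* p m n)) (sym (^-assocʳ x (p ℕ.^ m) (p ℕ.^ n)))

  frob-suc : ∀ n x → frob (suc n) x ≈ frob n x ^ p
  frob-suc n x = trans (^-congʳ x (ℕₚ.*-comm p (p ℕ.^ n))) (sym (^-assocʳ x (p ℕ.^ n) p))

  frob-* : ∀ n x y → frob n (x * y) ≈ frob n x * frob n y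
  frob-* n x y = ^-distrib-* x y (p ℕ.^ n)

  frob-+ : ∀ n x y → frob n (x + y) ≈ frob n x + frob n y
  frob-+ zero x y = trans (frob-zero _) (sym (+-cong (frob-zero x) (frob-zero y)))
  frob-+ (suc n) x y = begin
    frob (suc n) (x + y)               ≈⟨ frob-suc n _ ⟩
    frob n (x + y) ^ p                 ≈⟨ ^-congˡ p (frob-+ n x y) ⟩
    (frob n x + frob n y) ^ p          ≈⟨ ^p-+ _ _ ⟩
    frob n x ^ p + frob n y ^ p        ≈⟨ +-cong (frob-suc n x) (frob-suc n y) ⟨
    frob (suc n) x + frob (suc n) y    ∎

  frob-0# : ∀ n → frob n 0# ≈ 0#
  frob-0# n = +-cancelˡ (frob n 0#) _ _ (begin
    frob n 0# + frob n 0#   ≈⟨ frob-+ n 0# 0# ⟨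
    frob n (0# + 0#)        ≈⟨ frob-cong n (+-identityˡ 0#) ⟩
    frob n 0#               ≈⟨ +-identityʳ _ ⟨
    frob n 0# + 0#          ∎)

  -- Derived from additivity and not from the parity of `p`, so `p = 2` is no special case.
  frob-neg : ∀ n x → frob n (- x) ≈ - frob n x
  frob-neg n x = -‿unique _ _ (begin
    frob n x + frob n (- x)   ≈⟨ frob-+ n x (- x) ⟨
    frob n (x + - x)          ≈⟨ frob-cong n (-‿inverseʳ x) ⟩
    frob n 0#                 ≈⟨ frob-0# n ⟩
    0#                        ∎)

  p^1≡p : p ℕ.^ 1 ≡ p
  p^1≡p = ℕₚ.*-identityʳ p

  ^p-neg : ∀ x → (- x) ^ p ≈ - (x ^ p)
  ^p-neg x = trans (^-congʳ (- x) (≡.sym p^1≡p)) (trans (frob-neg 1 x) (-‿cong (^-congʳ x p^1≡p)))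

  scalar : Fin p → Carrier
  scalar k = toℕ k · 1#

  -- A Bézout relation between `suc k` and `p` would become `1# ≈ 0#`. Over the natural numbers the
  -- relation comes in two forms, depending on which side carries the extra 1.
  k·1≉0 : ∀ k → suc k < p → ¬ suc k · 1# ≈ 0#
  k·1≉0 k k<p k·1≈0 with coprime-Bézout (prime⇒coprime p-prime k<p)
  ... | Bézout.+- x y eq = 1≉0 (begin
    1#                              ≈⟨ +-identityʳ 1# ⟨
    1# + 0#                         ≈⟨ +-congˡ (trans (*-congˡ k·1≈0) (zeroʳ (y · 1#))) ⟨
    1# + (y · 1#) * (suc k · 1#)    ≈⟨ +-congˡ (×1-homo-* y (suc k)) ⟨
    (1 ℕ.+ y ℕ.* suc k) · 1#        ≈⟨ ×-congˡ eq ⟩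
    (x ℕ.* p) · 1#                  ≈⟨ p∣n⇒n·x≈0 1# (divides x ≡.refl) ⟩
    0#                              ∎)
  ... | Bézout.-+ x y eq = 1≉0 (begin
    1#                              ≈⟨ +-identityʳ 1# ⟨
    1# + 0#                         ≈⟨ +-congˡ (p∣n⇒n·x≈0 1# (divides x ≡.refl)) ⟨
    (1 ℕ.+ x ℕ.* p) · 1#            ≈⟨ ×-congˡ eq ⟩
    (y ℕ.* suc k) · 1#              ≈⟨ ×1-homo-* y (suc k) ⟩
    (y · 1#) * (suc k · 1#)         ≈⟨ trans (*-congˡ k·1≈0) (zeroʳ (y · 1#)) ⟩
    0#                              ∎)

  scalar-≮ : ∀ {i j} → i < j → j < p → ¬ i · 1# ≈ j · 1#
  scalar-≮ {i} {j} i<j j<p i≈j with ℕₚ.m≤n⇒∃[o]m+o≡n i<j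
  ... | d , ≡.refl = k·1≉0 d (ℕₚ.≤-<-trans (s≤s (ℕₚ.m≤n+m d i)) j<p) (+-cancelˡ (i · 1#) _ _ (begin
    i · 1# + suc d · 1#   ≈⟨ ×-homo-+ 1# i (suc d) ⟨
    (i ℕ.+ suc d) · 1#    ≈⟨ ×-congˡ (ℕₚ.+-suc i d) ⟩
    suc (i ℕ.+ d) · 1#    ≈⟨ i≈j ⟨
    i · 1#                ≈⟨ +-identityʳ _ ⟨
    i · 1# + 0#           ∎))

  scalar-injective : ∀ i j → scalar i ≈ scalar j → i ≡ j
  scalar-injective i j eq with Finₚ.<-cmp i j
  ... | tri< i<j _ _ = contradiction eq (scalar-≮ i<j (Finₚ.toℕ<n j))
  ... | tri≈ _ i≡j _ = i≡j
  ... | tri> _ _ j<i = contradiction (sym eq) (scalar-≮ j<i (Finₚ.toℕ<n i))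

  1^n≈1 : ∀ n → 1# ^ n ≈ 1#
  1^n≈1 zero    = refl
  1^n≈1 (suc n) = trans (*-identityˡ _) (1^n≈1 n)

  -- Fermat's little theorem, by induction on `k` through additivity of the `p`-th power.
  k·1^p≈k·1 : ∀ k → (k · 1#) ^ p ≈ k · 1#
  k·1^p≈k·1 zero    = zeroˡ _
  k·1^p≈k·1 (suc k) = trans (^p-+ 1# (k · 1#)) (+-cong (1^n≈1 p) (k·1^p≈k·1 k))

  -- The scalars are already `p` roots of the polynomial `X^p - X`; a fixed point outside them would
  -- be one root too many.
  fixed⇒scalar : ∀ z → z ^ p ≈ z → ∃ λ k → z ≈ scalar k
  fixed⇒scalar z z^p≈z with Finₚ.any? (λ k → z ≈? scalar k)
  ... | yes found = found
  ... | no  ¬found = contradiction (trans (sym c-lead) (eval-roots c root root-injective c[root]≈0 (fromℕ p))) 1≉0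
    where
    c : Fin (suc p) → Carrier
    -- The coefficients of `X^p - X`. As `p` is at least 2, the two positions differ and the leading
    -- coefficient is `1#`.
    c i = δ (fromℕ p) i + - 1# * δ (suc zero) i
    c-lead : c (fromℕ p) ≈ 1#
    c-lead = trans (+-cong (δ-refl (fromℕ p)) (trans (*-congˡ (δ-≢ {i = suc zero} {fromℕ p} λ ())) (zeroʳ _))) (+-identityʳ 1#)
    root : Fin (suc p) → Carrier
    root zero    = z
    root (suc k) = scalar k
    root-injective : ∀ i j → root i ≈ root j → i ≡ j
    root-injective zero    zero    _ = ≡.refl
    root-injective zero    (suc j) e = contradiction (j , e) ¬found
    root-injective (suc i) zero    e = contradiction (i , sym e) ¬found
    root-injective (suc i) (suc j) e = ≡.cong suc (scalar-injective i j e)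
    root^p≈root : ∀ i → root i ^ p ≈ root i
    root^p≈root zero    = z^p≈z
    root^p≈root (suc k) = k·1^p≈k·1 (toℕ k)
    c[root]≈0 : ∀ i → eval c (root i) ≈ 0#
    c[root]≈0 i = begin
      eval c x                                                ≈⟨ eval-+ _ _ x ⟩
      eval (δ (fromℕ p)) x + eval (λ i → - 1# * δ (suc zero) i) x
        ≈⟨ +-cong (trans (eval-δ (fromℕ p) x) (^-congʳ x (Finₚ.toℕ-fromℕ p))) (trans (eval-* (- 1#) _ x) (*-congˡ (eval-δ (suc zero) x))) ⟩
      x ^ p + - 1# * (x * 1#)                                 ≈⟨ +-cong (root^p≈root i) (trans (-1*x≈-x _) (-‿cong (*-identityʳ x))) ⟩
      x + - x                                                 ≈⟨ -‿inverseʳ x ⟩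
      0#                                                      ∎
      where x = root i

  -- The absolute trace when `q ≡ p ^ n`. Shorter partial traces are needed as well: for cutting the
  -- trace in two halves and as coefficients of `resolvent`.
  trace : ℕ → Carrier → Carrier
  trace zero    x = 0#
  trace (suc n) x = trace n x + frob n x

  trace-cong : ∀ n {x y} → x ≈ y → trace n x ≈ trace n y
  trace-cong zero    x≈y = refl
  trace-cong (suc n) x≈y = +-cong (trace-cong n x≈y) (frob-cong n x≈y)

  trace-neg : ∀ n x → trace n x + trace n (- x) ≈ 0#
  trace-neg zero    x = +-identityˡ 0#
  trace-neg (suc n) x = begin
    (trace n x + frob n x) + (trace n (- x) + frob n (- x))
      ≈⟨ solve 4 (λ a b c d → (a :+ b) :+ (c :+ d) := (a :+ c) :+ (b :+ d)) refl _ _ _ _ ⟩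
    (trace n x + trace n (- x)) + (frob n x + frob n (- x))
      ≈⟨ +-cong (trace-neg n x) (trans (+-congˡ (frob-neg n x)) (-‿inverseʳ _)) ⟩
    0# + 0# ≈⟨ +-identityˡ 0# ⟩
    0#      ∎

  trace-split : ∀ m n x → trace (m ℕ.+ n) x ≈ trace m x + trace n (frob m x)
  trace-split m zero x =
    trans (reflexive (≡.cong (λ k → trace k x) (ℕₚ.+-identityʳ m))) (sym (+-identityʳ _))
  trace-split m (suc n) x = begin
    trace (m ℕ.+ suc n) x                                ≡⟨ ≡.cong (λ k → trace k x) (ℕₚ.+-suc m n) ⟩
    trace (m ℕ.+ n) x + frob (m ℕ.+ n) x                 ≈⟨ +-cong (trace-split m n x) (frob-∘ m n x) ⟩
    (trace m x + trace n (frob m x)) + frob n (frob m x) ≈⟨ +-assoc _ _ _ ⟩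
    trace m x + trace (suc n) (frob m x)                 ∎

  -- Frobenius moves each conjugate to the next; adding `x` restores the lowest one.
  trace-^p : ∀ n x → trace n x ^ p + x ≈ trace (suc n) x
  trace-^p zero x = +-cong (zeroˡ _) (sym (frob-zero x))
  trace-^p (suc n) x = begin
    (trace n x + frob n x) ^ p + x             ≈⟨ +-congʳ (^p-+ _ _) ⟩
    (trace n x ^ p + frob n x ^ p) + x         ≈⟨ solve 3 (λ a b c → (a :+ b) :+ c := (a :+ c) :+ b) refl _ _ _ ⟩
    (trace n x ^ p + x) + frob n x ^ p         ≈⟨ +-cong (trace-^p n x) (sym (frob-suc n x)) ⟩
    trace (suc n) x + frob (suc n) x           ∎

  -- The bound `n < N` keeps every exponent `p ^ i` below `q`, so `q` coefficients suffice. The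
  -- coefficient of the linear term is recorded because it shows that the polynomial is not zero.
  traceCoeffs : ∀ {N} → q ≡ p ℕ.^ N → (1<q : 1 < q) → ∀ n → n < N → Σ (Fin q → Carrier) λ c →
    c (fromℕ< 1<q) ≈ 1# × (∀ x → eval c x ≈ trace (suc n) x)
  traceCoeffs q≡p^N 1<q zero n<N = δ one , δ-refl one , λ x → begin
    eval (δ one) x  ≈⟨ eval-δ one x ⟩
    x ^ toℕ one     ≈⟨ ^-congʳ x (Finₚ.toℕ-fromℕ< 1<q) ⟩
    x ^ 1           ≈⟨ +-identityˡ _ ⟨
    0# + x ^ 1      ∎
    where one = fromℕ< 1<q
  traceCoeffs {N} q≡p^N 1<q (suc n) n<N with traceCoeffs q≡p^N 1<q n (ℕₚ.<-trans (ℕₚ.n<1+n n) n<N)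
  ... | c , c₁≈1 , c≈trace = (λ i → c i + δ k i) , trans (+-cong c₁≈1 (δ-≢ k≢1)) (+-identityʳ 1#) , λ x → begin
    eval (λ i → c i + δ k i) x        ≈⟨ eval-+ c (δ k) x ⟩
    eval c x + eval (δ k) x           ≈⟨ +-cong (c≈trace x) (trans (eval-δ k x) (^-congʳ x (Finₚ.toℕ-fromℕ< p^n<q))) ⟩
    trace (suc n) x + frob (suc n) x  ∎
    where
    p^n<q : p ℕ.^ suc n < q
    p^n<q = ≡.subst (p ℕ.^ suc n <_) (≡.sym q≡p^N) (ℕₚ.^-monoʳ-< p (s≤s (s≤s z≤n)) n<N)
    k = fromℕ< p^n<q
    -- The new exponent `p ^ suc n` exceeds 1, so the linear coefficient stays `1#`.
    k≢1 : k ≢ fromℕ< 1<q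
    k≢1 k≡1 = ℕₚ.<⇒≢ (ℕₚ.^-monoʳ-< p (s≤s (s≤s z≤n)) (s≤s (z≤n {n})))
      (≡.sym (≡.trans (≡.sym (Finₚ.toℕ-fromℕ< p^n<q)) (≡.trans (≡.cong toℕ k≡1) (Finₚ.toℕ-fromℕ< 1<q))))

  -- The trace is a nonzero polynomial of degree less than q.
  trace-nontrivial : ∀ n → q ≡ p ℕ.^ suc n → ∃ λ θ → ¬ trace (suc n) θ ≈ 0#
  trace-nontrivial n q≡p^[1+n] with Finₚ.¬∀⟶∃¬ q (λ i → trace (suc n) (elt i) ≈ 0#) (λ i → trace (suc n) (elt i) ≈? 0#) not-all
    where
    1<q : 1 < q
    1<q = ≡.subst (1 <_) (≡.sym q≡p^[1+n]) (ℕₚ.^-monoʳ-< p (s≤s (s≤s z≤n)) (s≤s (z≤n {n})))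
    not-all : ¬ (∀ i → trace (suc n) (elt i) ≈ 0#)
    not-all trace≈0 with traceCoeffs q≡p^[1+n] 1<q n (ℕₚ.n<1+n n)
    ... | c , c₁≈1 , c≈trace = 1≉0 (trans (sym c₁≈1)
      (eval-roots c elt elt-injective (λ i → trans (c≈trace (elt i)) (trace≈0 i)) (fromℕ< 1<q)))
  ... | i , trace≉0 = elt i , trace≉0

  -- The classical sum of additive Hilbert 90: the conjugate of `θ` numbered `i` is weighted by the
  -- sum of the first `i` conjugates of `c`.
  resolvent : Carrier → Carrier → ℕ → Carrier
  resolvent c θ zero    = 0#
  resolvent c θ (suc n) = resolvent c θ n + trace n c * frob n θ

  -- Under Frobenius the weight `trace i c` becomes `trace (suc i) c - c` while `θ` advances by one
  -- conjugate. Up to the correction by `c` this is the resolvent with one more term, since its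
  -- weight at `i = 0` is zero.
  resolvent-^p : ∀ c θ n → resolvent c θ n ^ p + c * trace n θ ^ p ≈ resolvent c θ (suc n)
  resolvent-^p c θ zero = +-cong (zeroˡ _) (trans (*-congˡ (zeroˡ _)) (trans (zeroʳ c) (sym (zeroˡ _))))
  resolvent-^p c θ (suc n) = begin
    (w + s * t) ^ p + c * (u + t) ^ p
      ≈⟨ +-cong (trans (^p-+ w (s * t)) (+-congˡ (^-distrib-* s t p))) (*-congˡ (^p-+ u t)) ⟩
    (w ^ p + s ^ p * t ^ p) + c * (u ^ p + t ^ p)
      ≈⟨ solve 5 (λ a b d e f → (a :+ b :* d) :+ e :* (f :+ d) := (a :+ e :* f) :+ (b :+ e) :* d) refl
           (w ^ p) (s ^ p) (t ^ p) c (u ^ p) ⟩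
    (w ^ p + c * u ^ p) + (s ^ p + c) * t ^ p
      ≈⟨ +-cong (resolvent-^p c θ n) (*-cong (trace-^p n c) (sym (frob-suc n θ))) ⟩
    resolvent c θ (suc n) + trace (suc n) c * frob (suc n) θ ∎
    where
    w = resolvent c θ n
    s = trace n c
    t = frob n θ
    u = trace n θ

  -- Additive Hilbert 90.
  artinSchreier-solvable : ∀ n → q ≡ p ℕ.^ suc n → ∀ c → trace (suc n) c ≈ 0# → ∃ λ y → y ^ p ≈ c + y
  artinSchreier-solvable n q≡p^N c trace[c]≈0 with trace-nontrivial n q≡p^N
  ... | θ , τ≉0 with inverse (trace (suc n) θ) τ≉0
  -- The shift of the resolvent yields `w ^ p + c * τ ≈ w`. Dividing by `τ` gives `v = w * u` with
  -- `v ^ p + c ≈ v`, so `- v` is a solution.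
  ... | u , τ*u≈1 = - (w * u) , (begin
    (- (w * u)) ^ p                  ≈⟨ ^p-neg (w * u) ⟩
    - ((w * u) ^ p)                  ≈⟨ -‿unique _ _ (begin
      (w * u) ^ p + (c + - (w * u))    ≈⟨ +-assoc _ _ _ ⟨
      ((w * u) ^ p + c) + - (w * u)    ≈⟨ +-congʳ v^p+c≈v ⟩
      w * u + - (w * u)                ≈⟨ -‿inverseʳ _ ⟩
      0#                               ∎) ⟨
    c + - (w * u)                    ∎)
    where
    N = suc n
    τ = trace N θ
    w = resolvent c θ N
    -- Frobenius permutes the conjugates in the full trace cyclically because `θ ^ q ≈ θ`. Hence `τ`
    -- and its inverse are fixed by Frobenius, which makes the division by `τ` legitimate.
    τ^p≈τ : τ ^ p ≈ τ
    τ^p≈τ = +-cancelʳ θ _ _ (trans (trace-^p N θ) (+-congˡ (trans (^-congʳ θ (≡.sym q≡p^N)) (x^q≈x θ))))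
    u^p≈u : u ^ p ≈ u
    u^p≈u = begin
      u ^ p               ≈⟨ *-identityʳ _ ⟨
      u ^ p * 1#          ≈⟨ *-congˡ τ*u≈1 ⟨
      u ^ p * (τ * u)     ≈⟨ *-assoc _ _ _ ⟨
      (u ^ p * τ) * u     ≈⟨ *-congʳ (*-congˡ τ^p≈τ) ⟨
      (u ^ p * τ ^ p) * u ≈⟨ *-congʳ (^-distrib-* u τ p) ⟨
      (u * τ) ^ p * u     ≈⟨ *-congʳ (trans (^-congˡ p (trans (*-comm u τ) τ*u≈1)) (1^n≈1 p)) ⟩
      1# * u              ≈⟨ *-identityˡ u ⟩
      u                   ∎
    w^p+cτ≈w : w ^ p + c * τ ≈ w
    w^p+cτ≈w = begin
      w ^ p + c * τ             ≈⟨ +-congˡ (*-congˡ τ^p≈τ) ⟨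
      w ^ p + c * τ ^ p         ≈⟨ resolvent-^p c θ N ⟩
      w + trace N c * frob N θ  ≈⟨ +-congˡ (trans (*-congʳ trace[c]≈0) (zeroˡ _)) ⟩
      w + 0#                    ≈⟨ +-identityʳ w ⟩
      w                         ∎
    v^p+c≈v : (w * u) ^ p + c ≈ w * u
    v^p+c≈v = begin
      (w * u) ^ p + c             ≈⟨ +-cong (trans (^-distrib-* w u p) (*-congˡ u^p≈u)) (sym (trans (*-congˡ τ*u≈1) (*-identityʳ c))) ⟩
      w ^ p * u + c * (τ * u)     ≈⟨ solve 4 (λ a b c t → a :* b :+ c :* (t :* b) := (a :+ c :* t) :* b) refl (w ^ p) u c τ ⟩
      (w ^ p + c * τ) * u         ≈⟨ *-congʳ w^p+cτ≈w ⟩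
      w * u                       ∎

  fiber-nonempty : ∀ h → 1 ≤ h → q ≡ p ℕ.^ (h ℕ.+ h) → ∀ a x → InA R p h a →
                   ∃ λ y → y ^ p ≈ a * x ^ (p ℕ.^ h ℕ.+ 1) + y
  fiber-nonempty h@(suc h′) 1≤h q≡p^2h a x a∈A =
    artinSchreier-solvable (h′ ℕ.+ h) q≡p^2h c (begin
      trace (h ℕ.+ h) c             ≈⟨ trace-split h h c ⟩
      trace h c + trace h (frob h c) ≈⟨ +-congˡ (trace-cong h frob[c]≈-c) ⟩
      trace h c + trace h (- c)     ≈⟨ trace-neg h c ⟩
      0#                            ∎)
    where
    P = p ℕ.^ h
    c = a * x ^ (P ℕ.+ 1)
    P*P≡q : P ℕ.* P ≡ q
    P*P≡q = ≡.trans (≡.sym (ℕₚ.^-distribˡ-+-* p h h)) (≡.sym q≡p^2h)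
    exponent : (P ℕ.+ 1) ℕ.* P ≡ q ℕ.+ P
    exponent = ≡.trans (ℕₚ.*-distribʳ-+ P P 1) (≡.cong₂ ℕ._+_ P*P≡q (ℕₚ.*-identityˡ P))
    frob[x] : frob h (x ^ (P ℕ.+ 1)) ≈ x ^ (P ℕ.+ 1)
    frob[x] = begin
      (x ^ (P ℕ.+ 1)) ^ P      ≈⟨ ^-assocʳ x (P ℕ.+ 1) P ⟩
      x ^ ((P ℕ.+ 1) ℕ.* P)    ≈⟨ ^-congʳ x exponent ⟩
      x ^ (q ℕ.+ P)            ≈⟨ ^-homo-* x q P ⟩
      x ^ q * x ^ P            ≈⟨ *-congʳ (x^q≈x x) ⟩
      x * x ^ P                ≈⟨ ^-congʳ x (ℕₚ.+-comm 1 P) ⟩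
      x ^ (P ℕ.+ 1)            ∎
    frob[c]≈-c : frob h c ≈ - c
    frob[c]≈-c = -‿unique _ _ (begin
      a * x ^ (P ℕ.+ 1) + frob h c                 ≈⟨ +-congˡ (trans (frob-* h a _) (*-congˡ frob[x])) ⟩
      a * x ^ (P ℕ.+ 1) + frob h a * x ^ (P ℕ.+ 1) ≈⟨ distribʳ _ _ _ ⟨
      (a + frob h a) * x ^ (P ℕ.+ 1)               ≈⟨ *-congʳ (trans (+-comm _ _) a∈A) ⟩
      0# * x ^ (P ℕ.+ 1)                           ≈⟨ zeroˡ _ ⟩
      0#                                           ∎)

-- Counting by injections, and the coding of tuples by numbers.

-- Says that at least `a` indices satisfy `P`, in the same form as `WeightAtLeast`.
Embedding : ℕ → ∀ {N} → (Fin N → Set) → Set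
Embedding a {N} P = Σ (Fin a → Fin N) λ f → (∀ u v → f u ≡ f v → u ≡ v) × (∀ u → P (f u))

embed-skip : ∀ {a N} {P : Fin (suc N) → Set} → Embedding a (P ∘ suc) → Embedding a P
embed-skip (f , f-inj , Pf) = suc ∘ f , (λ u v e → f-inj u v (Finₚ.suc-injective e)) , Pf

embed-keep : ∀ {a N} {P : Fin (suc N) → Set} → P zero → Embedding a (P ∘ suc) → Embedding (suc a) P
embed-keep {a} {N} {P} P₀ (f , f-inj , Pf) = g , g-inj , Pg
  where
  g : Fin (suc a) → Fin (suc N)
  g zero    = zero
  g (suc u) = suc (f u)
  g-inj : ∀ u v → g u ≡ g v → u ≡ v
  g-inj zero    zero    _ = ≡.refl
  g-inj (suc u) (suc v) e = ≡.cong suc (f-inj u v (Finₚ.suc-injective e))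
  Pg : ∀ u → P (g u)
  Pg zero    = P₀
  Pg (suc u) = Pf u

embed-≤ : ∀ {a b N} {P : Fin N → Set} → a ≤ b → Embedding b P → Embedding a P
embed-≤ a≤b (f , f-inj , Pf) =
  (λ u → f (inject≤ u a≤b)) , (λ u v e → Finₚ.inject≤-injective a≤b a≤b u v (f-inj _ _ e)) , (λ u → Pf _)

-- The two sizes add up to `N`, which converts an upper bound for roots into a lower bound for
-- nonroots.
partition : ∀ {N} {P : Fin N → Set} → (∀ i → Dec (P i)) →
            ∃ λ a → ∃ λ b → a ℕ.+ b ≡ N × Embedding a P × Embedding b (¬_ ∘ P)
partition {zero} P? = 0 , 0 , ≡.refl , ((λ ()) , (λ ()) , λ ()) , ((λ ()) , (λ ()) , λ ())
partition {suc N} {P} P? with P? zero | partition (P? ∘ suc)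
... | yes P₀ | a , b , a+b≡N , f , g = suc a , b , ≡.cong suc a+b≡N , embed-keep {P = P} P₀ f , embed-skip {P = ¬_ ∘ P} g
... | no ¬P₀ | a , b , a+b≡N , f , g =
  a , suc b , ≡.trans (ℕₚ.+-suc a b) (≡.cong suc a+b≡N) , embed-skip {P = P} f , embed-keep {P = ¬_ ∘ P} ¬P₀ g

remQuot-injective : ∀ {m} n (i j : Fin (m ℕ.* n)) → quotient {m} n i ≡ quotient {m} n j →
                    remainder {m} n i ≡ remainder {m} n j → i ≡ j
remQuot-injective {m} n i j eq₁ eq₂ = ≡.trans (≡.sym (Finₚ.combine-remQuot {m} n i))
  (≡.trans (≡.cong₂ combine eq₁ eq₂) (Finₚ.combine-remQuot {m} n j))

funToFin-cong : ∀ {m n} {f g : Fin m → Fin n} → (∀ k → f k ≡ g k) → funToFin f ≡ funToFin g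
funToFin-cong {zero}  f≗g = ≡.refl
funToFin-cong {suc m} f≗g = ≡.cong₂ combine (f≗g zero) (funToFin-cong (f≗g ∘ suc))

finToFun-injective : ∀ {m n} (u v : Fin (n ℕ.^ m)) →
                     (∀ k → finToFun {n} {m} u k ≡ finToFun {n} {m} v k) → u ≡ v
finToFun-injective {m} {n} u v u≗v = ≡.trans (≡.sym (Finₚ.funToFin-finToFin {m} {n} u))
  (≡.trans (funToFin-cong {m} {n} u≗v) (Finₚ.funToFin-finToFin {m} {n} v))

-- Polynomials in several variables: nonroots on grids, restriction to lines, comparison with
-- `evalV`.

module Polynomials (R : CommutativeRing 0ℓ 0ℓ) (isField : IsField R)
                   {q : ℕ} (hasOrder : HasOrder R q) where
  open CommutativeRing R hiding (zero)
  open Sums R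
  open FiniteField R isField hasOrder
  open import Relation.Binary.Reasoning.Setoid setoid
  open import Algebra.Solver.Ring.NaturalCoefficients.Default commutativeSemiring
    using (solve; _:=_; _:*_)

  -- With more than `d` roots among the points, `eval-roots` would force `c i` to vanish; so at most
  -- `d` of the `N` points are roots.
  nonroots : ∀ {d e N} (c : Fin (suc d) → Carrier) i → ¬ c i ≈ 0# → e ℕ.+ d ≤ N →
             (s : Fin N → Carrier) → (∀ i j → s i ≈ s j → i ≡ j) →
             Embedding e (λ i → ¬ eval c (s i) ≈ 0#)
  nonroots {d} {e} {N} c i ci≉0 e+d≤N s s-inj with partition (λ i → eval c (s i) ≈? 0#)
  ... | a , b , a+b≡N , roots , others with suc d ℕ.≤? a
  ...   | yes d<a = contradiction
            (let f , f-inj , c[f]≈0 = embed-≤ {P = λ i → eval c (s i) ≈ 0#} d<a roots in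
             eval-roots c (s ∘ f) (λ i j e → f-inj i j (s-inj _ _ e)) c[f]≈0 i) ci≉0
  ...   | no  d≮a = embed-≤ {P = λ i → ¬ eval c (s i) ≈ 0#} e≤b others
    where
    e≤b : e ≤ b
    e≤b = ℕₚ.+-cancelʳ-≤ d e b (ℕₚ.≤-trans e+d≤N (ℕₚ.≤-trans (ℕₚ.≤-reflexive (≡.trans (≡.sym a+b≡N) (ℕₚ.+-comm a b)))
      (ℕₚ.+-monoʳ-≤ b (ℕₚ.≤-pred (ℕₚ.≰⇒> d≮a)))))

  -- The exponents are the `t` digits of `u` in base `m`.
  monomial : ∀ {m t} → Fin (m ℕ.^ t) → (Fin t → Carrier) → Carrier
  monomial {m} {t} u y = product λ k → y k ^ toℕ (finToFun {m} {t} u k)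

  polynomial : ∀ {m t} → (Fin (m ℕ.^ t) → Carrier) → (Fin t → Carrier) → Carrier
  polynomial {m} {t} γ y = sum λ u → γ u * monomial {m} {t} u y

  monomial-combine : ∀ {m t} i (u : Fin (m ℕ.^ t)) y →
    monomial {m} {suc t} (combine i u) y ≈ y zero ^ toℕ i * monomial {m} {t} u (y ∘ suc)
  monomial-combine {m} {t} i u y = trans (product-∷ _) (*-cong
    (^-congʳ (y zero) (≡.cong (toℕ ∘ proj₁) split))
    (product-cong λ k → ^-congʳ (y (suc k)) (≡.cong (λ iu → toℕ (finToFun {m} {t} (proj₂ iu) k)) split)))
    where split = Finₚ.remQuot-combine {m} {m ℕ.^ t} i u

  polynomial-suc : ∀ {m t} (γ : Fin (m ℕ.^ suc t) → Carrier) y →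
    polynomial {m} {suc t} γ y ≈ eval (λ i → polynomial {m} {t} (λ u → γ (combine i u)) (y ∘ suc)) (y zero)
  polynomial-suc {m} {t} γ y = trans (sum-combine m _) (sum-cong λ i → begin
    sum (λ u → γ (combine i u) * monomial {m} {suc t} (combine i u) y)
      ≈⟨ sum-cong (λ u → trans (*-congˡ (monomial-combine {m} {t} i u y))
           (solve 3 (λ a b c → a :* (b :* c) := (a :* c) :* b) refl _ _ _)) ⟩
    sum (λ u → (γ (combine i u) * monomial {m} {t} u (y ∘ suc)) * y zero ^ toℕ i)
      ≈⟨ *-distribʳ-sum (y zero ^ toℕ i) _ ⟨
    polynomial {m} {t} (λ u → γ (combine i u)) (y ∘ suc) * y zero ^ toℕ i ∎)

  -- Each variable has degree at most d and ranges over d + 2 values, so it can be specialised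
  -- in two ways without killing the polynomial.
  grid-nonroots : ∀ d t (γ : Fin (suc d ℕ.^ t) → Carrier) u → ¬ γ u ≈ 0# →
    (s : Fin t → Fin (2 ℕ.+ d) → Carrier) → (∀ k i j → s k i ≈ s k j → i ≡ j) →
    Σ (Fin (2 ℕ.^ t) → Fin t → Fin (2 ℕ.+ d)) λ D →
      (∀ v w → (∀ k → D v k ≡ D w k) → v ≡ w) ×
      (∀ v → ¬ polynomial {suc d} {t} γ (λ k → s k (D v k)) ≈ 0#)
  grid-nonroots d zero γ zero γ≉0 s s-inj =
    (λ _ ()) , (λ { zero zero _ → ≡.refl }) , λ _ poly≈0 → γ≉0 (begin
      γ zero                           ≈⟨ *-identityʳ _ ⟨
      γ zero * 1#                      ≈⟨ *-congˡ (product-[] _) ⟨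
      γ zero * product _               ≈⟨ sum-single {1} _ zero (λ { zero 0≢0 → contradiction ≡.refl 0≢0 }) ⟨
      polynomial {suc d} {0} γ _       ≈⟨ poly≈0 ⟩
      0#                               ∎)
  grid-nonroots d (suc t) γ u γ≉0 s s-inj = D , D-inj , D-nonroot
    where
    m = suc d
    i₀ = quotient {m} (m ℕ.^ t) u
    u₀ = remainder {m} (m ℕ.^ t) u

    γ₀≉0 : ¬ γ (combine i₀ u₀) ≈ 0#
    γ₀≉0 = ≡.subst (λ v → ¬ γ v ≈ 0#) (≡.sym (Finₚ.combine-remQuot {m} (m ℕ.^ t) u)) γ≉0

    -- Recursion on the slice of `γ` that contains the nonzero coefficient, namely the coefficient
    -- of the `i₀`-th power of the first variable.
    rest = grid-nonroots d t (λ v → γ (combine i₀ v)) u₀ γ₀≉0 (s ∘ suc) (s-inj ∘ suc)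

    coeffs : Fin (2 ℕ.^ t) → Fin m → Carrier
    coeffs v i = polynomial {m} {t} (λ u → γ (combine i u)) (λ k → s (suc k) (proj₁ rest v k))

    -- At a point good for the slice, coefficient `i₀` survives; a degree of at most `d` on `d + 2`
    -- values leaves two nonroots.
    first : ∀ v → Embedding 2 (λ i → ¬ eval (coeffs v) (s zero i) ≈ 0#)
    first v = nonroots (coeffs v) i₀ (proj₂ (proj₂ rest) v) ℕₚ.≤-refl (s zero) (s-inj zero)

    D : Fin (2 ℕ.* 2 ℕ.^ t) → Fin (suc t) → Fin (2 ℕ.+ d)
    D w zero    = proj₁ (first (remainder {2} (2 ℕ.^ t) w)) (quotient {2} (2 ℕ.^ t) w)
    D w (suc k) = proj₁ rest (remainder {2} (2 ℕ.^ t) w) k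

    D-inj : ∀ v w → (∀ k → D v k ≡ D w k) → v ≡ w
    D-inj v w D≗ = remQuot-injective {2} (2 ℕ.^ t) v w
      -- The two choices for the first variable depend on the remaining ones, so the first digits
      -- can be compared only after `rem≡`.
      (proj₁ (proj₂ (first (remainder {2} (2 ℕ.^ t) w))) _ _
        (≡.subst (λ x → proj₁ (first x) (quotient {2} (2 ℕ.^ t) v) ≡ D w zero) rem≡ (D≗ zero)))
      rem≡
      where
      rem≡ : remainder {2} (2 ℕ.^ t) v ≡ remainder {2} (2 ℕ.^ t) w
      rem≡ = proj₁ (proj₂ rest) _ _ (D≗ ∘ suc)

    D-nonroot : ∀ w → ¬ polynomial {m} {suc t} γ (λ k → s k (D w k)) ≈ 0#
    D-nonroot w poly≈0 = proj₂ (proj₂ (first (remainder {2} (2 ℕ.^ t) w))) (quotient {2} (2 ℕ.^ t) w)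
      (trans (sym (polynomial-suc {m} {t} γ _)) poly≈0)

  term : ∀ {l m t} → Fin (suc l ℕ.* m ℕ.^ t) → Pt R t → Carrier
  term {l} {m} {t} w (x , y) =
    x ^ toℕ (quotient {suc l} (m ℕ.^ t) w) * monomial {m} {t} (remainder {suc l} (m ℕ.^ t) w) y

  evaluate : ∀ {l m t} → (Fin (suc l ℕ.* m ℕ.^ t) → Carrier) → Pt R t → Carrier
  evaluate {l} {m} {t} γ P = sum λ w → γ w * term {l} {m} {t} w P

  term-combine : ∀ {l m t} j (u : Fin (m ℕ.^ t)) x y →
    term {l} {m} {t} (combine j u) (x , y) ≈ x ^ toℕ j * monomial {m} {t} u y
  term-combine {l} {m} {t} j u x y = reflexive
    (≡.cong (λ ju → x ^ toℕ (proj₁ ju) * monomial {m} {t} (proj₂ ju) y) (Finₚ.remQuot-combine {suc l} j u))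

  evaluate-polynomial : ∀ {l m t} (γ : Fin (suc l ℕ.* m ℕ.^ t) → Carrier) x y →
    evaluate {l} {m} {t} γ (x , y) ≈ polynomial {m} {t} (λ u → eval {suc l} (λ j → γ (combine j u)) x) y
  evaluate-polynomial {l} {m} {t} γ x y = begin
    evaluate {l} {m} {t} γ (x , y)
      ≈⟨ sum-combine (suc l) _ ⟩
    sum {suc l} (λ j → sum λ u → γ (combine j u) * term {l} {m} {t} (combine j u) (x , y))
      ≈⟨ sum-comm _ ⟩
    sum (λ u → sum {suc l} λ j → γ (combine j u) * term {l} {m} {t} (combine j u) (x , y))
      ≈⟨ sum-cong (λ u → trans (sum-cong λ j → trans (*-congˡ (term-combine {l} {m} {t} j u x y)) (sym (*-assoc _ _ _)))
           (sym (*-distribʳ-sum (monomial {m} {t} u y) _))) ⟩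
    polynomial {m} {t} (λ u → eval {suc l} (λ j → γ (combine j u)) x) y ∎

  evaluate-cong : ∀ {l m t} (γ : Fin (suc l ℕ.* m ℕ.^ t) → Carrier) {P P′} → _≈Pt_ R P P′ →
                  evaluate {l} {m} {t} γ P ≈ evaluate {l} {m} {t} γ P′
  evaluate-cong {l} {m} {t} γ (x≈x′ , y≈y′) = sum-cong λ w → *-congˡ (*-cong
    (^-congˡ (toℕ (quotient {suc l} (m ℕ.^ t) w)) x≈x′)
    (product-cong λ k → ^-congˡ (toℕ (finToFun {m} {t} (remainder {suc l} (m ℕ.^ t) w) k)) (y≈y′ k)))

  -- With all coordinates but the `j`-th frozen, each monomial is a constant `α w` times a power of
  -- that coordinate, and `δ` sorts these terms by exponent. One `b` serves the whole line.
  evaluate-line : ∀ {l m t} (γ : Fin (suc l ℕ.* m ℕ.^ t) → Carrier) (P : Pt R t) j →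
    Σ (Fin m → Carrier) λ b → ∀ P′ → proj₁ P′ ≈ proj₁ P → (∀ k → k ≢ j → proj₂ P′ k ≈ proj₂ P k) →
      evaluate {l} {m} {t} γ P′ ≈ eval b (proj₂ P′ j)
  evaluate-line {l} {m} {suc t} γ (x , y) j = (λ i → sum λ w → α w * δ (e w j) i) , λ
    { (x′ , y′) x′≈x y′≈y → begin
      evaluate {l} {m} {suc t} γ (x′ , y′)
        ≈⟨ sum-cong (λ w → *-congˡ (*-cong (^-congˡ (d w) x′≈x)
             (trans (product-remove j _) (*-congˡ (product-cong λ k →
               ^-congˡ (toℕ (e w (punchIn j k))) (y′≈y _ (Finₚ.punchInᵢ≢i j k))))))) ⟩
      sum (λ w → γ w * (x ^ d w * (y′ j ^ toℕ (e w j) * others w)))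
        ≈⟨ sum-cong (λ w → solve 4 (λ a b c d → a :* (b :* (c :* d)) := (a :* (b :* d)) :* c) refl
             (γ w) (x ^ d w) (y′ j ^ toℕ (e w j)) (others w)) ⟩
      sum (λ w → α w * y′ j ^ toℕ (e w j))
        ≈⟨ sum-cong (λ w → trans (eval-* (α w) (δ (e w j)) (y′ j)) (*-congˡ (eval-δ (e w j) (y′ j)))) ⟨
      sum (λ w → eval (λ i → α w * δ (e w j) i) (y′ j))
        ≈⟨ eval-sum (λ w i → α w * δ (e w j) i) (y′ j) ⟨
      eval (λ i → sum λ w → α w * δ (e w j) i) (y′ j) ∎ }
    where
    d : Fin (suc l ℕ.* m ℕ.^ suc t) → ℕ
    d w = toℕ (quotient {suc l} (m ℕ.^ suc t) w)
    e : Fin (suc l ℕ.* m ℕ.^ suc t) → Fin (suc t) → Fin m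
    e w = finToFun {m} {suc t} (remainder {suc l} (m ℕ.^ suc t) w)
    others α : Fin (suc l ℕ.* m ℕ.^ suc t) → Carrier
    others w = product λ k → y (punchIn j k) ^ toℕ (e w (punchIn j k))
    α w = γ w * (x ^ d w * others w)

  -- The tuples in the definition of ΣFun are given by a pattern-matching lambda, which has no name;
  -- since coefficient functions need not respect pointwise equality, that very function is
  -- recovered here by unification.
  ΣFun-unfold : ∀ t m (g : (Fin (suc t) → Fin m) → Carrier) →
    Σ (Fin m → (Fin t → Fin m) → Fin (suc t) → Fin m) λ cons →
      ΣFun R (suc t) m g ≡ (Σ[_]_ R m λ i → ΣFun R t m λ e → g (cons i e))
  ΣFun-unfold t m g = _ , ≡.refl

  ΣFun-unfold₀ : ∀ m (g : (Fin 0 → Fin m) → Carrier) →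
    Σ (Fin 0 → Fin m) λ nil → ΣFun R 0 m g ≡ g nil
  ΣFun-unfold₀ m g = _ , ≡.refl

  cons : ∀ t m → Fin m → (Fin t → Fin m) → Fin (suc t) → Fin m
  cons t m = proj₁ (ΣFun-unfold t m λ _ → 0#)

  tuple : ∀ m t → Fin (m ℕ.^ t) → Fin t → Fin m
  tuple m zero    u = proj₁ (ΣFun-unfold₀ m λ _ → 0#)
  tuple m (suc t) u =
    cons t m (quotient (m ℕ.^ t) u) (tuple m t (remainder {m} (m ℕ.^ t) u))

  -- Agreement is only pointwise: exponents may be rewritten along it, but the argument of an
  -- arbitrary `coef` may not.
  tuple≗finToFun : ∀ m t (u : Fin (m ℕ.^ t)) k → tuple m t u k ≡ finToFun {m} {t} u k
  tuple≗finToFun m (suc t) u zero    = ≡.refl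
  tuple≗finToFun m (suc t) u (suc k) = tuple≗finToFun m t (remainder {m} (m ℕ.^ t) u) k

  ΣFun≈sum : ∀ m t (g : (Fin t → Fin m) → Carrier) → ΣFun R t m g ≈ sum λ u → g (tuple m t u)
  ΣFun≈sum m zero g = sym (sum-single {1} _ zero λ { zero 0≢0 → contradiction ≡.refl 0≢0 })
  ΣFun≈sum m (suc t) g = begin
    ΣFun R (suc t) m g
      ≡⟨ Σ≡sum _ ⟩
    sum (λ i → ΣFun R t m λ e → g (cons t m i e))
      ≈⟨ sum-cong (λ i → ΣFun≈sum m t λ e → g (cons t m i e)) ⟩
    sum (λ i → sum λ u → g (cons t m i (tuple m t u)))
      ≈⟨ sum-cong (λ i → sum-cong λ u → reflexive (≡.cong (λ iu → g (cons t m (proj₁ iu) (tuple m t (proj₂ iu)))) (Finₚ.remQuot-combine {m} i u))) ⟨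
    sum (λ i → sum λ u → g (tuple m (suc t) (combine i u)))
      ≈⟨ sum-combine m _ ⟨
    sum (λ u → g (tuple m (suc t) u)) ∎

  evalV≈evaluate : ∀ p t l coef P → evalV R p t l coef P ≈
    evaluate {l} {p ∸ 1} {t} (λ w → coef (quotient {suc l} ((p ∸ 1) ℕ.^ t) w) (tuple (p ∸ 1) t (remainder {suc l} ((p ∸ 1) ℕ.^ t) w))) P
  evalV≈evaluate p t l coef (x , y) = begin
    evalV R p t l coef (x , y)
      ≡⟨ Σ≡sum _ ⟩
    sum {suc l} (λ j → ΣFun R t m (λ e → coef j e * (x ^ toℕ j * (Π[_]_ R t λ k → y k ^ toℕ (e k)))))
      ≈⟨ sum-cong (λ j → ΣFun≈sum m t _) ⟩
    sum {suc l} (λ j → sum λ u → coef j (tuple m t u) * (x ^ toℕ j * (Π[_]_ R t λ k → y k ^ toℕ (tuple m t u k))))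
      ≈⟨ sum-cong (λ j → sum-cong λ u → *-congˡ (*-congˡ (trans (reflexive (Π≡product _))
           (product-cong λ k → ^-congʳ (y k) (≡.cong toℕ (tuple≗finToFun m t u k)))))) ⟩
    sum {suc l} (λ j → sum λ u → coef j (tuple m t u) * (x ^ toℕ j * monomial {m} {t} u y))
      ≈⟨ sum-cong (λ j → sum-cong λ u → reflexive (≡.cong (λ ju → coef (proj₁ ju) (tuple m t (proj₂ ju)) * (x ^ toℕ (proj₁ ju) * monomial {m} {t} (proj₂ ju) y))
           (Finₚ.remQuot-combine {suc l} j u))) ⟨
    sum {suc l} (λ j → sum λ u → summand (combine j u))
      ≈⟨ sum-combine (suc l) summand ⟨
    sum summand ∎
    where
    m = p ∸ 1
    summand : Fin (suc l ℕ.* m ℕ.^ t) → Carrier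
    summand w = coef (quotient {suc l} (m ℕ.^ t) w) (tuple m t (remainder {suc l} (m ℕ.^ t) w)) * term {l} {m} {t} w (x , y)

  -- The coefficient function built here factors through `funToFin`, hence depends only on the
  -- values of the exponent vector.
  evaluate≈evalV : ∀ p t l (γ : Fin (suc l ℕ.* (p ∸ 1) ℕ.^ t) → Carrier) P →
    evalV R p t l (λ j e → γ (combine j (funToFin e))) P ≈ evaluate {l} {p ∸ 1} {t} γ P
  evaluate≈evalV p t l γ P = trans (evalV≈evaluate p t l (λ j e → γ (combine j (funToFin e))) P) (sum-cong λ w → *-congʳ (reflexive (≡.cong γ
    (≡.trans (≡.cong (combine (quotient {suc l} (m ℕ.^ t) w))
               (≡.trans (funToFin-cong (tuple≗finToFun m t (remainder {suc l} (m ℕ.^ t) w)))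
                        (Finₚ.funToFin-finToFin {t} {m} (remainder {suc l} (m ℕ.^ t) w))))
             (Finₚ.combine-remQuot {suc l} (m ℕ.^ t) w)))))
    where m = p ∸ 1

-- The points of B and the parameters of the code.

module Code (R : CommutativeRing 0ℓ 0ℓ) (isField : IsField R) {q : ℕ} (hasOrder : HasOrder R q)
            {r : ℕ} (p-prime : Prime (2 ℕ.+ r)) (h : ℕ) (1≤h : 1 ≤ h) (q≡p^2h : q ≡ (2 ℕ.+ r) ℕ.^ (h ℕ.+ h))
            {t : ℕ} (a : Fin t → CommutativeRing.Carrier R) (a∈A : ∀ i → InA R (2 ℕ.+ r) h (a i))
            {n : ℕ} (Q : Fin n → Pt R t) (ordering : IsOrderingOfB R (2 ℕ.+ r) h t n a Q) where
  open CommutativeRing R hiding (zero)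
  open Sums R
  open FiniteField R isField hasOrder
  open Frobenius R isField hasOrder p-prime (characteristic {2 ℕ.+ r} {h ℕ.+ h} q≡p^2h)
  open Polynomials R isField hasOrder
  open import Relation.Binary.Reasoning.Setoid setoid
  open import Algebra.Properties.AbelianGroup +-abelianGroup
    using () renaming (∙-cancelˡ to +-cancelˡ)
  open import Algebra.Solver.Ring.NaturalCoefficients.Default commutativeSemiring
    using (solve; _:=_; _:+_)

  Point : Set
  Point = Pt R t

  infix 4 _≈ᴾ_
  _≈ᴾ_ : Point → Point → Set
  _≈ᴾ_ = _≈Pt_ R

  ≈ᴾ-sym : ∀ {P P′} → P ≈ᴾ P′ → P′ ≈ᴾ P
  ≈ᴾ-sym (x≈ , y≈) = sym x≈ , sym ∘ y≈

  ≈ᴾ-trans : ∀ {P P′ P″} → P ≈ᴾ P′ → P′ ≈ᴾ P″ → P ≈ᴾ P″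
  ≈ᴾ-trans (x≈ , y≈) (x≈′ , y≈′) = trans x≈ x≈′ , λ k → trans (y≈ k) (y≈′ k)

  -- The curve equation without subtraction, the form in which additivity of the `p`-th power
  -- applies directly.
  OnCurve : Fin t → Carrier → Carrier → Set
  OnCurve k x y = y ^ p ≈ a k * x ^ (p ℕ.^ h ℕ.+ 1) + y

  InB⇒OnCurve : ∀ {x y} → InB R p h t a (x , y) → ∀ k → OnCurve k x (y k)
  InB⇒OnCurve {x} {y} inB k = begin
    y k ^ p                    ≈⟨ +-identityʳ _ ⟨
    y k ^ p + 0#               ≈⟨ +-congˡ (-‿inverseˡ (y k)) ⟨
    y k ^ p + (- y k + y k)    ≈⟨ +-assoc _ _ _ ⟨
    (y k ^ p - y k) + y k      ≈⟨ +-congʳ (inB k) ⟩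
    a k * x ^ (p ℕ.^ h ℕ.+ 1) + y k ∎

  OnCurve⇒InB : ∀ {x y} → (∀ k → OnCurve k x (y k)) → InB R p h t a (x , y)
  OnCurve⇒InB {x} {y} curve k = begin
    y k ^ p - y k                             ≈⟨ +-congʳ (curve k) ⟩
    (a k * x ^ (p ℕ.^ h ℕ.+ 1) + y k) - y k   ≈⟨ +-assoc _ _ _ ⟩
    a k * x ^ (p ℕ.^ h ℕ.+ 1) + (y k - y k)   ≈⟨ +-congˡ (-‿inverseʳ (y k)) ⟩
    a k * x ^ (p ℕ.^ h ℕ.+ 1) + 0#            ≈⟨ +-identityʳ _ ⟩
    a k * x ^ (p ℕ.^ h ℕ.+ 1)                 ∎

  OnCurve-cong : ∀ k {x x′ y y′} → x ≈ x′ → y ≈ y′ → OnCurve k x y → OnCurve k x′ y′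
  OnCurve-cong k x≈x′ y≈y′ curve = trans (^-congˡ p (sym y≈y′))
    (trans curve (+-cong (*-congˡ (^-congˡ (p ℕ.^ h ℕ.+ 1) x≈x′)) y≈y′))

  translate : ∀ k {x y} i → OnCurve k x y → OnCurve k x (y + scalar i)
  translate k {x} {y} i curve = begin
    (y + scalar i) ^ p                                ≈⟨ ^p-+ y (scalar i) ⟩
    y ^ p + scalar i ^ p                              ≈⟨ +-cong curve (k·1^p≈k·1 (toℕ i)) ⟩
    (a k * x ^ (p ℕ.^ h ℕ.+ 1) + y) + scalar i        ≈⟨ +-assoc _ _ _ ⟩
    a k * x ^ (p ℕ.^ h ℕ.+ 1) + (y + scalar i)        ∎

  is-translate : ∀ k {x y y′} → OnCurve k x y → OnCurve k x y′ → ∃ λ i → y′ ≈ y + scalar i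
  is-translate k {x} {y} {y′} curve curve′ =
    let i , z≈i = fixed⇒scalar z z^p≈z in i , trans (sym y+z≈y′) (+-congˡ z≈i)
    where
    z = y′ - y
    c = a k * x ^ (p ℕ.^ h ℕ.+ 1)
    y+z≈y′ : y + z ≈ y′
    y+z≈y′ = begin
      y + (y′ - y)     ≈⟨ solve 3 (λ a b c → a :+ (b :+ c) := b :+ (c :+ a)) refl y y′ (- y) ⟩
      y′ + (- y + y)   ≈⟨ +-congˡ (-‿inverseˡ y) ⟩
      y′ + 0#          ≈⟨ +-identityʳ y′ ⟩
      y′               ∎
    z^p≈z : z ^ p ≈ z
    z^p≈z = +-cancelˡ (y ^ p) _ _ (begin
      y ^ p + z ^ p    ≈⟨ ^p-+ y z ⟨
      (y + z) ^ p      ≈⟨ ^-congˡ p y+z≈y′ ⟩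
      y′ ^ p           ≈⟨ curve′ ⟩
      c + y′           ≈⟨ +-congˡ y+z≈y′ ⟨
      c + (y + z)      ≈⟨ +-assoc _ _ _ ⟨
      (c + y) + z      ≈⟨ +-congʳ curve ⟨
      y ^ p + z        ∎)

  base : Fin t → Carrier → Carrier
  base k x = proj₁ (fiber-nonempty h 1≤h q≡p^2h (a k) x (a∈A k))

  base-OnCurve : ∀ k x → OnCurve k x (base k x)
  base-OnCurve k x = proj₂ (fiber-nonempty h 1≤h q≡p^2h (a k) x (a∈A k))

  grid : Carrier → Fin t → Fin p → Carrier
  grid x k i = base k x + scalar i

  grid-injective : ∀ x k i j → grid x k i ≈ grid x k j → i ≡ j
  grid-injective x k i j e = scalar-injective i j (+-cancelˡ (base k x) _ _ e)

  point : Fin q → (Fin t → Fin p) → Point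
  point i D = elt i , λ k → grid (elt i) k (D k)

  point-injective : ∀ i j D E → point i D ≈ᴾ point j E → i ≡ j × (∀ k → D k ≡ E k)
  point-injective i j D E (x≈ , y≈) with elt-injective i j x≈
  ... | ≡.refl = ≡.refl , λ k → grid-injective (elt i) k (D k) (E k) (y≈ k)

  Q∈B : ∀ i k → OnCurve k (proj₁ (Q i)) (proj₂ (Q i) k)
  Q∈B i = InB⇒OnCurve (proj₁ ordering i)

  Q-injective : ∀ i j → Q i ≈ᴾ Q j → i ≡ j
  Q-injective = proj₁ (proj₂ ordering)

  position : (P : Point) → (∀ k → OnCurve k (proj₁ P) (proj₂ P k)) → ∃ λ i → Q i ≈ᴾ P
  position P curve = proj₂ (proj₂ ordering) P (OnCurve⇒InB curve)

  position-point : ∀ i D → ∃ λ j → Q j ≈ᴾ point i D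
  position-point i D = position (point i D) λ k → translate k (D k) (base-OnCurve k (elt i))

  coordinates : ∀ i → ∃ λ j → ∃ λ D → Q i ≈ᴾ point j D
  coordinates i = j , proj₁ ∘ digit , sym (elt-index x) , proj₂ ∘ digit
    where
    x = proj₁ (Q i)
    j = index x
    digit : ∀ k → ∃ λ d → proj₂ (Q i) k ≈ grid (elt j) k d
    digit k = is-translate k (base-OnCurve k (elt j)) (OnCurve-cong k (sym (elt-index x)) refl (Q∈B i k))

  -- Two injections suffice for the length: points are sent to coordinates here and coordinates to
  -- points in `p^t*q≤n`, and the two maps need not be shown mutually inverse.
  n≤p^t*q : n ≤ p ℕ.^ t ℕ.* q
  n≤p^t*q = Finₚ.injective⇒≤ {f = code} λ {i} {j} eq →
    let j₁ , D₁ , Q₁ = coordinates i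
        j₂ , D₂ , Q₂ = coordinates j
        D≡ , j≡ = Finₚ.combine-injective (funToFin D₁) j₁ (funToFin D₂) j₂ eq
        D≗ = λ k → ≡.trans (≡.sym (Finₚ.finToFun-funToFin D₁ k))
               (≡.trans (≡.cong (λ u → finToFun {p} {t} u k) D≡) (Finₚ.finToFun-funToFin D₂ k))
    in Q-injective i j (≈ᴾ-trans Q₁ (≈ᴾ-trans (point-cong j≡ D≗) (≈ᴾ-sym Q₂)))
    where
    code : Fin n → Fin (p ℕ.^ t ℕ.* q)
    code i = combine (funToFin (proj₁ (proj₂ (coordinates i)))) (proj₁ (coordinates i))
    point-cong : ∀ {i j D E} → i ≡ j → (∀ k → D k ≡ E k) → point i D ≈ᴾ point j E
    point-cong {i} ≡.refl D≗E = refl , λ k → reflexive (≡.cong (grid (elt i) k) (D≗E k))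

  p^t*q≤n : p ℕ.^ t ℕ.* q ≤ n
  p^t*q≤n = Finₚ.injective⇒≤ {f = decode} λ {v} {w} eq →
    let i≡j , D≗E = point-injective (i v) (i w) (D v) (D w)
          (≈ᴾ-trans (≈ᴾ-sym (proj₂ (position-point (i v) (D v))))
            (≡.subst (λ j → Q j ≈ᴾ point (i w) (D w)) (≡.sym eq) (proj₂ (position-point (i w) (D w)))))
    in remQuot-injective {p ℕ.^ t} q v w (finToFun-injective {t} {p} _ _ D≗E) i≡j
    where
    i : Fin (p ℕ.^ t ℕ.* q) → Fin q
    i w = remainder {p ℕ.^ t} q w
    D : Fin (p ℕ.^ t ℕ.* q) → Fin t → Fin p
    D w = finToFun {p} {t} (quotient {p ℕ.^ t} q w)
    decode : Fin (p ℕ.^ t ℕ.* q) → Fin n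
    decode w = proj₁ (position-point (i w) (D w))

  module _ (l : ℕ) where
    m : ℕ
    m = suc r

    K : ℕ
    K = suc l ℕ.* m ℕ.^ t

    C : Word R n → Set
    C = InC R p t l n Q

    coefficients : ∀ {c} → C c → ∃ λ γ → ∀ i → c i ≈ evaluate {l} {m} {t} γ (Q i)
    coefficients (coef , c≈) = _ , λ i → trans (c≈ i) (evalV≈evaluate p t l coef (Q i))

    codeword : ∀ {c} (γ : Fin K → Carrier) → (∀ i → c i ≈ evaluate {l} {m} {t} γ (Q i)) → C c
    codeword γ c≈ = (λ j e → γ (combine j (funToFin e))) , λ i → trans (c≈ i) (sym (evaluate≈evalV p t l γ (Q i)))

    linear : IsLinear R n C
    linear =
      codeword (λ _ → 0#) (λ i → sym (sum-zero _ λ w → zeroˡ _)) ,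
      (λ c c′ c∈C c′∈C → let γ , c≈ = coefficients c∈C ; γ′ , c′≈ = coefficients c′∈C in
        codeword (λ w → γ w + γ′ w) λ i → trans (+-cong (c≈ i) (c′≈ i))
          (sym (trans (sum-cong λ w → distribʳ _ _ _) (sum-+ _ _)))) ,
      (λ s c c∈C → let γ , c≈ = coefficients c∈C in
        codeword (λ w → s * γ w) λ i → trans (*-congˡ (c≈ i))
          (trans (*-distribˡ-sum s _) (sum-cong λ w → sym (*-assoc _ _ _))))

    -- This single count yields both the independence of the evaluated monomials and the distance.
    nonzeros : ∀ {e} → e ℕ.+ l ≤ q → (γ : Fin K → Carrier) → ∀ w → ¬ γ w ≈ 0# →
               Embedding (e ℕ.* 2 ℕ.^ t) (λ i → ¬ evaluate {l} {m} {t} γ (Q i) ≈ 0#)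
    nonzeros {e} e+l≤q γ w γw≉0 = f , f-inj , f-nonzero
      where
      T = 2 ℕ.^ t
      j₀ = quotient {suc l} (m ℕ.^ t) w
      u₀ = remainder {suc l} (m ℕ.^ t) w

      X : Embedding e (λ i → ¬ eval (λ j → γ (combine j u₀)) (elt i) ≈ 0#)
      X = nonroots (λ j → γ (combine j u₀)) j₀
            (≡.subst (λ v → ¬ γ v ≈ 0#) (≡.sym (Finₚ.combine-remQuot {suc l} (m ℕ.^ t) w)) γw≉0)
            e+l≤q elt elt-injective

      -- At each such value of `x` the coefficient of the monomial `u₀` is nonzero, so the
      -- specialised polynomial meets the hypothesis of `grid-nonroots`, with `r + 2 = p` grid
      -- values and exponents up to `r = p - 2`.
      Y : ∀ v → _
      Y v = grid-nonroots r t (λ u → eval {suc l} (λ j → γ (combine j u)) (elt (proj₁ X v))) u₀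
              (proj₂ (proj₂ X) v) (grid (elt (proj₁ X v))) (grid-injective (elt (proj₁ X v)))

      i : Fin (e ℕ.* T) → Fin q
      i v = proj₁ X (quotient {e} T v)
      D : Fin (e ℕ.* T) → Fin t → Fin p
      D v = proj₁ (Y (quotient {e} T v)) (remainder {e} T v)
      f : Fin (e ℕ.* T) → Fin n
      f v = proj₁ (position-point (i v) (D v))

      f-inj : ∀ v v′ → f v ≡ f v′ → v ≡ v′
      f-inj v v′ eq = remQuot-injective {e} T v v′ quot≡
        (proj₁ (proj₂ (Y (quotient {e} T v′))) _ _ λ k →
          ≡.trans (≡.cong (λ x → proj₁ (Y x) (remainder {e} T v) k) (≡.sym quot≡)) (proj₂ same k))
        where
        same = point-injective (i v) (i v′) (D v) (D v′)
          (≈ᴾ-trans (≈ᴾ-sym (proj₂ (position-point (i v) (D v))))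
            (≡.subst (λ j → Q j ≈ᴾ point (i v′) (D v′)) (≡.sym eq) (proj₂ (position-point (i v′) (D v′)))))
        quot≡ = proj₁ (proj₂ X) _ _ (proj₁ same)

      f-nonzero : ∀ v → ¬ evaluate {l} {m} {t} γ (Q (f v)) ≈ 0#
      f-nonzero v eq = proj₂ (proj₂ (Y (quotient {e} T v))) (remainder {e} T v) (begin
        polynomial {m} {t} _ _
          ≈⟨ evaluate-polynomial {l} {m} {t} γ (elt (i v)) (λ k → grid (elt (i v)) k (D v k)) ⟨
        evaluate {l} {m} {t} γ (point (i v) (D v))
          ≈⟨ evaluate-cong {l} {m} {t} γ (proj₂ (position-point (i v) (D v))) ⟨
        evaluate {l} {m} {t} γ (Q (f v))
          ≈⟨ eq ⟩
        0# ∎)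

    dimension : ∀ {e} → 1 ≤ e → e ℕ.+ l ≤ q → HasDimension R n C K
    dimension {suc e} 1≤e e+l≤q =
      (λ w i → term {l} {m} {t} w (Q i)) ,
      (λ w → codeword (δ w) λ i → sym (sum-δ w (λ v → term {l} {m} {t} v (Q i)))) ,
      (λ λ′ comb≈0 w → decidable-stable (λ′ w ≈? 0#) λ λ′≉0 →
        let f , _ , nonzero = nonzeros e+l≤q λ′ w λ′≉0
            -- Any one nonzero position refutes the relation; index zero exists because `e` is
            -- positive.
            v = combine {suc e} zero (funToFin {t} {2} λ _ → zero)
        in nonzero v (trans (reflexive (≡.sym (Σ≡sum _))) (comb≈0 (f v)))) ,
      (λ c c∈C → let γ , c≈ = coefficients c∈C in γ , λ i → trans (c≈ i) (reflexive (≡.sym (Σ≡sum _))))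

    distance : ∀ {e d} → e ℕ.+ l ≤ q → d ≤ e ℕ.* 2 ℕ.^ t → MinDistAtLeast R n C d
    distance e+l≤q d≤ c c∈C c≉0 =
      let γ , c≈ = coefficients c∈C
          w , γw≉0 = Finₚ.¬∀⟶∃¬ K (λ w → γ w ≈ 0#) (λ w → γ w ≈? 0#) λ γ≈0 →
            c≉0 λ i → trans (c≈ i) (sum-zero _ λ w → trans (*-congʳ (γ≈0 w)) (zeroˡ _))
          f , f-inj , nonzero = embed-≤ {P = λ i → ¬ evaluate {l} {m} {t} γ (Q i) ≈ 0#} d≤ (nonzeros e+l≤q γ w γw≉0)
      in f , f-inj , λ u c≈0 → nonzero u (trans (sym (c≈ _)) c≈0)

    -- Recovery sets.

    A : Fin n → Fin t → Fin n → Set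
    A = RecSet R t n Q

    module _ (i : Fin n) (j : Fin t) where
      private
        α = proj₁ (Q i)
        β = proj₂ (Q i)

      -- Shifting by `scalar (suc d)` leaves out the shift by zero, which would give the position
      -- `i` itself; this accounts for the size `p - 1`.
      neighbour : Fin m → Point
      neighbour d = α , λ k → moved k (k Finₚ.≟ j)
        where
        moved : ∀ k → Dec (k ≡ j) → Carrier
        moved k (yes _) = β k + scalar (suc d)
        moved k (no  _) = β k

      neighbour-at : ∀ d → proj₂ (neighbour d) j ≈ β j + scalar (suc d)
      neighbour-at d with j Finₚ.≟ j
      ... | yes _   = refl
      ... | no  j≢j = contradiction ≡.refl j≢j

      neighbour-off : ∀ d k → k ≢ j → proj₂ (neighbour d) k ≈ β k
      neighbour-off d k k≢j with k Finₚ.≟ j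
      ... | yes k≡j = contradiction k≡j k≢j
      ... | no  _   = refl

      neighbour-OnCurve : ∀ d k → OnCurve k α (proj₂ (neighbour d) k)
      neighbour-OnCurve d k with k Finₚ.≟ j
      ... | yes _ = translate k (suc d) (Q∈B i k)
      ... | no  _ = Q∈B i k

      helper : Fin m → Fin n
      helper d = proj₁ (position (neighbour d) (neighbour-OnCurve d))

      Q-helper : ∀ d → Q (helper d) ≈ᴾ neighbour d
      Q-helper d = proj₂ (position (neighbour d) (neighbour-OnCurve d))

      helper-value : ∀ d → proj₂ (Q (helper d)) j ≈ β j + scalar (suc d)
      helper-value d = trans (proj₂ (Q-helper d) j) (neighbour-at d)

      value-injective : ∀ d e → proj₂ (Q (helper d)) j ≈ proj₂ (Q (helper e)) j → d ≡ e
      value-injective d e eq = Finₚ.suc-injective (scalar-injective (suc d) (suc e) (+-cancelˡ (β j) _ _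
        (trans (sym (helper-value d)) (trans eq (helper-value e)))))

      helper-injective : ∀ d e → helper d ≡ helper e → d ≡ e
      helper-injective d e eq = value-injective d e (reflexive (≡.cong (λ v → proj₂ (Q v) j) eq))

      helper≢i : ∀ d → helper d ≢ i
      helper≢i d eq = Finₚ.0≢1+n (scalar-injective zero (suc d) (+-cancelˡ (β j) _ _ (begin
        β j + 0#                ≈⟨ +-identityʳ _ ⟩
        β j                     ≡⟨ ≡.cong (λ v → proj₂ (Q v) j) eq ⟨
        proj₂ (Q (helper d)) j  ≈⟨ helper-value d ⟩
        β j + scalar (suc d)    ∎)))

      helper∈A : ∀ d → A i j (helper d)
      helper∈A d = helper≢i d , proj₁ (Q-helper d) ,
        λ k k≢j → trans (proj₂ (Q-helper d) k) (neighbour-off d k k≢j)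

      agree-at : ∀ {y y′ : Fin t → Carrier} → y j ≈ y′ j → (∀ k → k ≢ j → y k ≈ y′ k) → ∀ k → y k ≈ y′ k
      agree-at yj≈ y≈ k with k Finₚ.≟ j
      ... | yes ≡.refl = yj≈
      ... | no  k≢j    = y≈ k k≢j

      helper-surjective : ∀ i′ → A i j i′ → ∃ λ d → helper d ≡ i′
      helper-surjective i′ (i′≢i , x≈ , y≈) =
        find (is-translate j (Q∈B i j) (OnCurve-cong j x≈ refl (Q∈B i′ j)))
        where
        find : (∃ λ d → proj₂ (Q i′) j ≈ β j + scalar d) → ∃ λ d → helper d ≡ i′
        find (zero  , y′≈) =
          contradiction (Q-injective i′ i (x≈ , agree-at (trans y′≈ (+-identityʳ _)) y≈)) i′≢i
        find (suc d , y′≈) = d , Q-injective (helper d) i′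
          (trans (proj₁ (Q-helper d)) (sym x≈) , agree-at (trans (helper-value d) (sym y′≈))
            (λ k k≢j → trans (proj₂ (proj₂ (helper∈A d)) k k≢j) (sym (y≈ k k≢j))))

      -- Along the recovery set a codeword is a univariate polynomial of degree less than p − 1.
      recover : ∀ c c′ → C c → C c′ → (∀ i′ → A i j i′ → c i′ ≈ c′ i′) → c i ≈ c′ i
      recover c c′ c∈C c′∈C agree = begin
        c i              ≈⟨ c≈b i refl (λ _ _ → refl) ⟩
        eval b (β j)     ≈⟨ sum-cong (λ k → *-congʳ (b≈b′ k)) ⟩
        eval b′ (β j)    ≈⟨ c′≈b′ i refl (λ _ _ → refl) ⟨
        c′ i             ∎
        where
        γ = proj₁ (coefficients c∈C)
        γ′ = proj₁ (coefficients c′∈C)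
        b = proj₁ (evaluate-line {l} {m} {t} γ (Q i) j)
        b′ = proj₁ (evaluate-line {l} {m} {t} γ′ (Q i) j)
        c≈b : ∀ i′ → proj₁ (Q i′) ≈ α → (∀ k → k ≢ j → proj₂ (Q i′) k ≈ β k) → c i′ ≈ eval b (proj₂ (Q i′) j)
        c≈b i′ x≈ y≈ = trans (proj₂ (coefficients c∈C) i′) (proj₂ (evaluate-line {l} {m} {t} γ (Q i) j) (Q i′) x≈ y≈)
        c′≈b′ : ∀ i′ → proj₁ (Q i′) ≈ α → (∀ k → k ≢ j → proj₂ (Q i′) k ≈ β k) → c′ i′ ≈ eval b′ (proj₂ (Q i′) j)
        c′≈b′ i′ x≈ y≈ = trans (proj₂ (coefficients c′∈C) i′) (proj₂ (evaluate-line {l} {m} {t} γ′ (Q i) j) (Q i′) x≈ y≈)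
        b≈b′ : ∀ k → b k ≈ b′ k
        b≈b′ = eval-determined b b′ (λ d → proj₂ (Q (helper d)) j) value-injective λ d →
          let _ , x≈ , y≈ = helper∈A d in
          trans (sym (c≈b (helper d) x≈ y≈)) (trans (agree (helper d) (helper∈A d)) (c′≈b′ (helper d) x≈ y≈))

    availability : HasAvailabilityLocality R n t m C A
    availability =
      (λ i j i∈A → proj₁ i∈A ≡.refl) ,
      -- A common point agrees with position `i` off coordinate `j` by the first set, and at `j` by
      -- the second because `j ≢ j′`; it would then be `i` itself.
      (λ i j j′ i′ j≢j′ (i′≢i , x≈ , y≈) (_ , _ , y≈′) → i′≢i (Q-injective i′ i (x≈ , agree-at i j (y≈′ j j≢j′) y≈))) ,
      (λ i j → helper i j , helper-injective i j , helper∈A i j , helper-surjective i j) ,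
      recover

-- Numerical estimates and assembly.

open import Data.Nat using (_+_; _*_; _^_)

module _ (r : ℕ) where
  private
    p : ℕ
    p = 2 + r

  n<p^n : ∀ n → n < p ^ n
  n<p^n zero    = s≤s z≤n
  n<p^n (suc n) = begin-strict
    suc n             ≤⟨ n<p^n n ⟩
    p ^ n             <⟨ ℕₚ.^-monoʳ-< p (s≤s (s≤s z≤n)) (ℕₚ.n<1+n n) ⟩
    p ^ suc n         ∎
    where open ℕₚ.≤-Reasoning

  -- The truncated subtractions are exact: `t ≤ h < p ^ h` gives `t * p ^ h ≤ p ^ (h + h)`, and the
  -- term `2 * t * p ^ (h ∸ 1)` alone is at least `t`.
  degree+codegree : ∀ t h {q} → 1 ≤ h → t ≤ h → q ≡ p ^ (h + h) →
    t * (r * p ^ (h ∸ 1) + 1) + (q ∸ t * p ^ h + 2 * t * p ^ (h ∸ 1) ∸ t) ≡ q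
  degree+codegree t h@(suc h′) {q} 1≤h t≤h q≡p^2h = begin
    t * (r * P + 1) + (B ∸ t)        ≡⟨ solve 4 (λ t r P x → t :* (r :* P :+ con 1) :+ x := (x :+ t) :+ t :* (r :* P)) ≡.refl t r P (B ∸ t) ⟩
    (B ∸ t + t) + t * (r * P)        ≡⟨ ≡.cong (_+ t * (r * P)) (ℕₚ.m∸n+n≡m t≤B) ⟩
    B + t * (r * P)                  ≡⟨ solve 4 (λ a t r P → (a :+ con 2 :* t :* P) :+ t :* (r :* P) := a :+ t :* ((con 2 :+ r) :* P)) ≡.refl (q ∸ t * p ^ h) t r P ⟩
    q ∸ t * p ^ h + t * p ^ h        ≡⟨ ℕₚ.m∸n+n≡m t*p^h≤q ⟩
    q                                ∎
    where
    open ≡.≡-Reasoning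
    open +-*-Solver
    P = p ^ h′
    B = q ∸ t * p ^ h + 2 * t * P
    t≤B : t ≤ B
    t≤B = ℕₚ.≤-trans (ℕₚ.≤-trans (ℕₚ.m≤m+n t _) (ℕₚ.m≤m*n (2 * t) P {{ℕₚ.m^n≢0 p h′}})) (ℕₚ.m≤n+m (2 * t * P) (q ∸ t * p ^ h))
    t*p^h≤q : t * p ^ h ≤ q
    t*p^h≤q = ℕₚ.≤-trans (ℕₚ.*-monoˡ-≤ (p ^ h) (ℕₚ.≤-trans t≤h (ℕₚ.<⇒≤ (n<p^n h))))
      (ℕₚ.≤-reflexive (≡.trans (≡.sym (ℕₚ.^-distribˡ-+-* p h h)) (≡.sym q≡p^2h)))

  -- For `p = 2` both sides are equal. For larger `p` the factor `r * p ^ (h ∸ 1)` already dominates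
  -- `p ^ (t ∸ 1)`, because `t ≤ h`.
  distance-bound : ∀ t h → 1 ≤ t → t ≤ h → 2 * t * p ^ (t ∸ 1) ≤ t * (r * p ^ (h ∸ 1) + 1) * 2 ^ t
  distance-bound t@(suc t′) h@(suc h′) 1≤t (s≤s t′≤h′) = begin
    2 * t * p ^ t′                              ≤⟨ ℕₚ.*-monoʳ-≤ (2 * t) (bound r ≡.refl) ⟩
    2 * t * ((r * P + 1) * 2 ^ t′)              ≡⟨ solve 3 (λ t e T → con 2 :* t :* (e :* T) := t :* e :* (con 2 :* T)) ≡.refl t (r * P + 1) (2 ^ t′) ⟩
    t * (r * P + 1) * 2 ^ t                     ∎
    where
    open ℕₚ.≤-Reasoning
    open +-*-Solver
    P = p ^ h′
    -- The copy `s` of `r` permits the case distinction although `p` and `P` mention `r`; `s = 0` is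
    -- the case `p = 2`.
    bound : ∀ s → s ≡ r → p ^ t′ ≤ (r * P + 1) * 2 ^ t′
    bound zero    ≡.refl = ℕₚ.≤-reflexive (≡.sym (ℕₚ.*-identityˡ (2 ^ t′)))
    bound (suc s) ≡.refl = begin
      p ^ t′                     ≤⟨ ℕₚ.^-monoʳ-≤ p t′≤h′ ⟩
      P                          ≤⟨ ℕₚ.m≤m+n P (s * P) ⟩
      r * P                      ≤⟨ ℕₚ.m≤m+n (r * P) 1 ⟩
      r * P + 1                  ≤⟨ ℕₚ.m≤m*n (r * P + 1) (2 ^ t′) {{ℕₚ.m^n≢0 2 t′}} ⟩
      (r * P + 1) * 2 ^ t′       ∎

theorem7p1 : (p h q t n : ℕ) → Prime p → 1 ≤ h → q ≡ p ^ (2 * h) →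
  (R : CommutativeRing 0ℓ 0ℓ) → IsField R → HasOrder R q →
  (a : Fin h → CommutativeRing.Carrier R) → IsBasisOfA R p h a →
  1 ≤ t → (t≤h : t ≤ h) →
  (Q : Fin n → Pt R t) →
  IsOrderingOfB R p h t n (λ i → a (inject≤ i t≤h)) Q →
  let l = q ∸ t * p ^ h + 2 * t * p ^ (h ∸ 1) ∸ t
      C = InC R p t l n Q
  in IsLinear R n C
     × n ≡ p ^ t * q
     × HasDimension R n C ((q ∸ t * p ^ h + 2 * t * p ^ (h ∸ 1) ∸ t + 1) * (p ∸ 1) ^ t)
     × MinDistAtLeast R n C (2 * t * p ^ (t ∸ 1))
     × HasAvailabilityLocality R n t (p ∸ 1) C (RecSet R t n Q)
theorem7p1 0 h q t n p-prime = contradiction p-prime ¬prime[0]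
theorem7p1 1 h q t n p-prime = contradiction p-prime ¬prime[1]
theorem7p1 p@(suc (suc r)) h q t n p-prime 1≤h q≡p^2h R isField hasOrder a (a∈A , _) 1≤t t≤h Q ordering =
  linear l ,
  ℕₚ.≤-antisym n≤p^t*q p^t*q≤n ,
  ≡.subst (λ k → HasDimension R n (InC R p t l n Q) (k * (p ∸ 1) ^ t)) (ℕₚ.+-comm 1 l) (dimension l 1≤e e+l≤q) ,
  distance l e+l≤q (distance-bound r t h 1≤t t≤h) ,
  availability l
  where
  l = q ∸ t * p ^ h + 2 * t * p ^ (h ∸ 1) ∸ t
  e = t * (r * p ^ (h ∸ 1) + 1)
  q≡p^[h+h] : q ≡ p ^ (h + h)
  q≡p^[h+h] = ≡.trans q≡p^2h (≡.cong (λ k → p ^ (h + k)) (ℕₚ.+-identityʳ h))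
  open Code R isField hasOrder p-prime h 1≤h q≡p^[h+h] (λ i → a (inject≤ i t≤h)) (λ i → a∈A (inject≤ i t≤h)) Q ordering
  e+l≤q : e + l ≤ q
  e+l≤q = ℕₚ.≤-reflexive (degree+codegree r t h 1≤h t≤h q≡p^[h+h])
  1≤e : 1 ≤ e
  1≤e = ℕₚ.*-mono-≤ 1≤t (ℕₚ.m≤n+m 1 (r * p ^ (h ∸ 1)))
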